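{- Let $n\ge 0$ be an integer and let $x,y$ be complex numbers such that no denominator below vanishes, i.e. $x\notin\{ -1,\dots,-n\}$, $x-y\notin\{ -1,\dots,-n\}$ and $y\notin\{0,-1,\dots,-n\}$. Then $$\sum_{k=0}^n(-1)^k\binom{n}{k}\frac{\binom{2x-y+n+k}{k}\binom{y+k}{k}}{\binom{x+k}{k}^2}\frac{y}{y+k}H_{k}^{\langle2\rangle}(x)=\frac{\binom{x-y+n}{n}^2}{\binom{x+n}{n}^2}\Big\{H_{n}^{\langle2\rangle}(x)-H_{n}^{\langle2\rangle}(x-y)\Big\}.$$
   Context: For a complex number $u$ and an integer $k\ge 0$, $\binom{u}{k}=\frac{u(u-1)\cdots(u-k+1)}{k!}$ (equal to $1$ for $k=0$). For a complex number $u$ and a positive integer $\ell$, the generalized harmonic numbers of $\ell$-order are $H_0^{\langle\ell\rangle}(u)=0$ and $H_n^{\langle\ell\rangle}(u)=\sum_{k=1}^n\frac{1}{(u+k)^\ell}$ for $n\ge1$. -}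

module Defs where

open import Level using (0ℓ)
open import Algebra.Apartness.Bundles using (HeytingCommutativeRing; HeytingField)
open import Algebra.Bundles using (CommutativeRing)
import Algebra.Apartness.Properties.HeytingCommutativeRing as HeytingProperties
import Algebra.Properties.Group as GroupProperties
import Algebra.Properties.Semiring.Exp as Exp
import Algebra.Properties.Semiring.Mult as Mult
import Algebra.Properties.Semiring.Sum as Sum
open import Data.Empty using (⊥; ⊥-elim)
open import Data.Fin.Base using (toℕ)
open import Data.Fin.Properties using (toℕ≤pred[n])
open import Data.Nat.Base as ℕ using (ℕ; zero; suc; z≤n; s≤s; NonZero; _!)
import Data.Nat.Properties as ℕ
open import Data.Product.Base using (∃-syntax; _×_; _,_; proj₁; proj₂)
open import Data.Rational.Base as ℚ using (ℚ; 0ℚ; 1ℚ; ½; ∣_∣)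
import Data.Rational.Properties as ℚ
open import Data.Rational.Solver using (module +-*-Solver)
open import Data.Sum.Base as ⊎ using (_⊎_; inj₁; inj₂)
open import Function.Base using (_∘_)
open import Relation.Binary.Bundles using (Setoid)
open import Relation.Binary.PropositionalEquality as ≡ using (_≡_; _≢_)
import Relation.Binary.Reasoning.Setoid as ≈-Reasoning
open import Relation.Nullary using (¬_; yes; no)

------------------------------------------------------------------------
-- Binomial coefficients and generalized harmonic numbers over a Heyting
-- field of characteristic zero.

fromℕ : ∀ {c ℓ₁ ℓ₂} (F : HeytingField c ℓ₁ ℓ₂) → ℕ → HeytingField.Carrier F
fromℕ F n = n ×ⁿ 1#
  where
  open HeytingField F using (heytingCommutativeRing; 1#)
  open CommutativeRing (HeytingCommutativeRing.commutativeRing heytingCommutativeRing) using (semiring)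
  open Mult semiring using () renaming (_×_ to _×ⁿ_)

module CharacteristicZero
  {c ℓ₁ ℓ₂} (F : HeytingField c ℓ₁ ℓ₂)
  (suc#0 : ∀ n → HeytingField._#_ F (fromℕ F (suc n)) (HeytingField.0# F))
  where

  open HeytingField F
  open HeytingCommutativeRing heytingCommutativeRing using (commutativeRing)
  open CommutativeRing commutativeRing using (semiring; +-group)
  open HeytingProperties heytingCommutativeRing using (#-congʳ; invertibleˡ⇒#; 1#0; x#0y#0→xy#0; x-0≈x)
  open Exp semiring using (_^_) public
  open Mult semiring using (×-homo-+)
  open Sum semiring using (sum)
  open GroupProperties +-group using (⁻¹-involutive)

  infix 9 ⟦_⟧
  ⟦_⟧ : ℕ → Carrier
  ⟦ n ⟧ = fromℕ F n

  infixl 7 _/_[_]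
  _/_[_] : Carrier → (v : Carrier) → v # 0# → Carrier
  u / v [ v#0 ] = u * proj₁ (#⇒invertible v#0)

  -- ∑[k=0..n] f k, where the terms may use k ≤ n.
  ∑≤ : (n : ℕ) → ((k : ℕ) → k ℕ.≤ n → Carrier) → Carrier
  ∑≤ n f = sum {suc n} λ i → f (toℕ i) (toℕ≤pred[n] i)

  fallingFactorial : Carrier → ℕ → Carrier
  fallingFactorial u zero    = 1#
  fallingFactorial u (suc k) = fallingFactorial u k * (u - ⟦ k ⟧)

  opaque

    !#0 : ∀ k → ⟦ k ! ⟧ # 0#
    !#0 k = nonZero#0 (k !) {{k ℕ.!≢0}}
      where
      nonZero#0 : ∀ m → .{{NonZero m}} → ⟦ m ⟧ # 0#
      nonZero#0 (suc m) = suc#0 m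

    ^#0 : ∀ {u} ℓ → u # 0# → u ^ ℓ # 0#
    ^#0 zero    u#0 = 1#0
    ^#0 (suc ℓ) u#0 = x#0y#0→xy#0 u#0 (^#0 ℓ u#0)

  binom : Carrier → ℕ → Carrier
  binom u k = fallingFactorial u k / ⟦ k ! ⟧ [ !#0 k ]

  -- u ∉ {-a, …, -b}, in the positive form that makes u + j invertible
  -- for a ≤ j ≤ b; by tightness of _#_ it is classically just u ≠ -j.
  infix 4 _∉-[_⋯_]
  _∉-[_⋯_] : Carrier → ℕ → ℕ → Set ℓ₂
  u ∉-[ a ⋯ b ] = ∀ j → a ℕ.≤ j → j ℕ.≤ b → u # - ⟦ j ⟧

  restrict : ∀ {u a b b′} → b′ ℕ.≤ b → u ∉-[ a ⋯ b ] → u ∉-[ a ⋯ b′ ]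
  restrict b′≤b h j a≤j j≤b′ = h j a≤j (ℕ.≤-trans j≤b′ b′≤b)

  opaque

    +#0 : ∀ {u a b} → u ∉-[ a ⋯ b ] → ∀ j → a ℕ.≤ j → j ℕ.≤ b → u + ⟦ j ⟧ # 0#
    +#0 {u} h j a≤j j≤b with #⇒invertible (h j a≤j j≤b)
    ... | v , v*[u+j]≈1 , _ = invertibleˡ⇒# (v , trans (*-congˡ eq) v*[u+j]≈1)
      where
      eq : u + ⟦ j ⟧ - 0# ≈ u - - ⟦ j ⟧
      eq = trans (x-0≈x _)
                 (+-congˡ (sym (⁻¹-involutive ⟦ j ⟧)))

    binom#0 : ∀ {u} k → u ∉-[ 1 ⋯ k ] → binom (u + ⟦ k ⟧) k # 0#
    binom#0 {u} k h = x#0y#0→xy#0 (falling#0 k ℕ.≤-refl) (inverse#0 (!#0 k))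
      where
      open ≈-Reasoning setoid

      inverse#0 : ∀ {v} (v#0 : v # 0#) → proj₁ (#⇒invertible v#0) # 0#
      inverse#0 {v} v#0 = invertibleˡ⇒# (v - 0# , trans (*-congˡ (x-0≈x _))
        (proj₂ (proj₂ (#⇒invertible v#0))))

      factor : ∀ i → i ℕ.≤ k → u + ⟦ k ℕ.∸ i ⟧ ≈ u + ⟦ k ⟧ - ⟦ i ⟧
      factor i i≤k = begin
        u + ⟦ k ℕ.∸ i ⟧                       ≈⟨ +-congˡ (+-identityʳ _) ⟨
        u + (⟦ k ℕ.∸ i ⟧ + 0#)                ≈⟨ +-congˡ (+-congˡ (-‿inverseʳ ⟦ i ⟧)) ⟨
        u + (⟦ k ℕ.∸ i ⟧ + (⟦ i ⟧ - ⟦ i ⟧))   ≈⟨ +-congˡ (+-assoc _ _ _) ⟨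
        u + (⟦ k ℕ.∸ i ⟧ + ⟦ i ⟧ - ⟦ i ⟧)     ≈⟨ +-congˡ (+-congʳ (×-homo-+ 1# (k ℕ.∸ i) i)) ⟨
        u + (⟦ k ℕ.∸ i ℕ.+ i ⟧ - ⟦ i ⟧)       ≡⟨ ≡.cong (λ m → u + (⟦ m ⟧ - ⟦ i ⟧)) (ℕ.m∸n+n≡m i≤k) ⟩
        u + (⟦ k ⟧ - ⟦ i ⟧)                   ≈⟨ +-assoc _ _ _ ⟨
        u + ⟦ k ⟧ - ⟦ i ⟧                     ∎

      falling#0 : ∀ i → i ℕ.≤ k → fallingFactorial (u + ⟦ k ⟧) i # 0#
      falling#0 zero    _   = 1#0
      falling#0 (suc i) i<k = x#0y#0→xy#0 (falling#0 i (ℕ.<⇒≤ i<k))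
        (#-congʳ (factor i (ℕ.<⇒≤ i<k))
          (+#0 h (k ℕ.∸ i) (ℕ.m<n⇒0<n∸m i<k) (ℕ.m∸n≤m k i)))

  -- H ℓ n u is the generalized harmonic number ∑[k=1..n] 1 / (u + k)^ℓ.
  H : ∀ ℓ → .{{NonZero ℓ}} → ∀ n u → u ∉-[ 1 ⋯ n ] → Carrier
  H ℓ zero    u h = 0#
  H ℓ (suc n) u h = H ℓ n u (restrict (ℕ.n≤1+n n) h)
    + 1# / (u + ⟦ suc n ⟧) ^ ℓ [ ^#0 ℓ (+#0 h (suc n) (s≤s z≤n) ℕ.≤-refl) ]

------------------------------------------------------------------------
-- Real numbers: Cauchy sequences of rationals, compared up to null
-- sequences.

module Real where

  open import Data.Rational.Base using (_+_; _*_; _-_; -_; _<_; _≤_)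

  Eventually : (ℕ → Set) → Set
  Eventually P = ∃[ N ] ∀ n → N ℕ.≤ n → P n

  Cauchy : (ℕ → ℚ) → Set
  Cauchy s = ∀ ε → 0ℚ < ε →
    ∃[ N ] ∀ m n → N ℕ.≤ m → N ℕ.≤ n → ∣ s m - s n ∣ < ε

  Null : (ℕ → ℚ) → Set
  Null s = ∀ ε → 0ℚ < ε → Eventually λ n → ∣ s n ∣ < ε

  Away : (ℕ → ℚ) → Set
  Away s = ∃[ ε ] 0ℚ < ε × Eventually λ n → ε ≤ ∣ s n ∣

  record ℝ : Set where
    constructor real
    field
      seq    : ℕ → ℚ
      cauchy : Cauchy seq

  open ℝ public

  infix 4 _≈ᴿ_ _#ᴿ_

  _≈ᴿ_ _#ᴿ_ : ℝ → ℝ → Set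
  x ≈ᴿ y = Null λ n → seq x n - seq y n
  x #ᴿ y = Away λ n → seq x n - seq y n

  Bounded : (ℕ → ℚ) → Set
  Bounded s = ∃[ B ] 0ℚ < B × Eventually λ n → ∣ s n ∣ ≤ B

  opaque

    ev-map : ∀ {P Q : ℕ → Set} → (∀ n → P n → Q n) →
             Eventually P → Eventually Q
    ev-map f (N , p) = N , λ n h → f n (p n h)

    ev-zip : ∀ {P Q R : ℕ → Set} → (∀ n → P n → Q n → R n) →
             Eventually P → Eventually Q → Eventually R
    ev-zip f (M , p) (N , q) = M ℕ.⊔ N , λ n h →
      f n (p n (ℕ.m⊔n≤o⇒m≤o M N h)) (q n (ℕ.m⊔n≤o⇒n≤o M N h))

    half-pos : ∀ {ε} → 0ℚ < ε → 0ℚ < ½ * ε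
    half-pos {ε} h = ≡.subst (_< ½ * ε) (ℚ.*-zeroʳ ½) (ℚ.*-monoʳ-<-pos ½ h)

    halves : ∀ ε → ½ * ε + ½ * ε ≡ ε
    halves = solve 1 (λ e → con ½ :* e :+ con ½ :* e := e) ≡.refl
      where open +-*-Solver

    *-pos : ∀ {a b} → 0ℚ < a → 0ℚ < b → 0ℚ < a * b
    *-pos {a} {b} 0<a 0<b = ≡.subst (_< a * b) (ℚ.*-zeroʳ a)
      (ℚ.*-monoʳ-<-pos a {{ℚ.positive 0<a}} 0<b)

    ∣∣-*-mono : ∀ {a b A B} → ∣ a ∣ ≤ A → ∣ b ∣ ≤ B → ∣ a * b ∣ ≤ A * B
    ∣∣-*-mono {a} {b} {A} {B} p q = begin
      ∣ a * b ∣       ≡⟨ ℚ.∣p*q∣≡∣p∣*∣q∣ a b ⟩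
      ∣ a ∣ * ∣ b ∣   ≤⟨ ℚ.*-monoʳ-≤-nonNeg ∣ b ∣ {{ℚ.∣-∣-nonNeg b}} p ⟩
      A * ∣ b ∣       ≤⟨ ℚ.*-monoˡ-≤-nonNeg A {{ℚ.nonNegative (ℚ.≤-trans (ℚ.0≤∣p∣ a) p)}} q ⟩
      A * B           ∎
      where open ℚ.≤-Reasoning

    *-mono-away : ∀ {a b A B} → 0ℚ ≤ A → A ≤ ∣ a ∣ → 0ℚ ≤ B → B ≤ ∣ b ∣ → A * B ≤ ∣ a * b ∣
    *-mono-away {a} {b} {A} {B} 0≤A p 0≤B q = begin
      A * B           ≤⟨ ℚ.*-monoʳ-≤-nonNeg B {{ℚ.nonNegative 0≤B}} p ⟩
      ∣ a ∣ * B       ≤⟨ ℚ.*-monoˡ-≤-nonNeg ∣ a ∣ {{ℚ.∣-∣-nonNeg a}} q ⟩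
      ∣ a ∣ * ∣ b ∣   ≡⟨ ℚ.∣p*q∣≡∣p∣*∣q∣ a b ⟨
      ∣ a * b ∣       ∎
      where open ℚ.≤-Reasoning

    ∣+∣< : ∀ {ε} a b → ∣ a ∣ < ½ * ε → ∣ b ∣ < ½ * ε → ∣ a + b ∣ < ε
    ∣+∣< {ε} a b p q = begin-strict
      ∣ a + b ∣       ≤⟨ ℚ.∣p+q∣≤∣p∣+∣q∣ a b ⟩
      ∣ a ∣ + ∣ b ∣   <⟨ ℚ.+-mono-< p q ⟩
      ½ * ε + ½ * ε   ≡⟨ halves ε ⟩
      ε               ∎
      where open ℚ.≤-Reasoning

    -- ½ ε ≤ ∣ a ∣ whenever ε ≤ ∣ a + b ∣ and ∣ b ∣ < ½ ε.
    away-shift : ∀ {ε} a b → ε ≤ ∣ a + b ∣ → ∣ b ∣ < ½ * ε → ½ * ε ≤ ∣ a ∣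
    away-shift {ε} a b p q with ½ * ε ℚ.≤? ∣ a ∣
    ... | yes h = h
    ... | no  h = ⊥-elim (ℚ.<-irrefl ≡.refl (ℚ.<-≤-trans (∣+∣< a b (ℚ.≰⇒> h) q) p))

    -- The inverse on ℚ, made total by 0 ↦ 0; only its values away
    -- from 0 matter below.
    inv : ℚ → ℚ
    inv q with q ℚ.≟ 0ℚ
    ... | yes _   = 0ℚ
    ... | no  q≢0 = (ℚ.1/ q) {{ℚ.≢-nonZero q≢0}}

    *-inv : ∀ q → q ≢ 0ℚ → q * inv q ≡ 1ℚ
    *-inv q q≢0 with q ℚ.≟ 0ℚ
    ... | yes q≡0 = ⊥-elim (q≢0 q≡0)
    ... | no  q≢0 = ℚ.*-inverseʳ q {{ℚ.≢-nonZero q≢0}}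

    away⇒≢0 : ∀ {ε a} → 0ℚ < ε → ε ≤ ∣ a ∣ → a ≢ 0ℚ
    away⇒≢0 0<ε ε≤ ≡.refl = ℚ.<-irrefl ≡.refl (ℚ.<-≤-trans 0<ε ε≤)

    pos⇒≢0 : ∀ {ε} → 0ℚ < ε → ε ≢ 0ℚ
    pos⇒≢0 0<ε ≡.refl = ℚ.<-irrefl ≡.refl 0<ε

    ∣inv∣≤ : ∀ {ε a} → 0ℚ < ε → ε ≤ ∣ a ∣ → ∣ inv a ∣ ≤ inv ε
    ∣inv∣≤ {ε} {a} 0<ε ε≤ = ℚ.*-cancelˡ-≤-pos ε {{ℚ.positive 0<ε}} (begin
      ε * ∣ inv a ∣       ≤⟨ ℚ.*-monoʳ-≤-nonNeg ∣ inv a ∣ {{ℚ.∣-∣-nonNeg (inv a)}} ε≤ ⟩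
      ∣ a ∣ * ∣ inv a ∣   ≡⟨ ℚ.∣p*q∣≡∣p∣*∣q∣ a (inv a) ⟨
      ∣ a * inv a ∣       ≡⟨ ≡.cong ∣_∣ (*-inv a (away⇒≢0 0<ε ε≤)) ⟩
      1ℚ                  ≡⟨ *-inv ε (pos⇒≢0 0<ε) ⟨
      ε * inv ε           ∎)
      where open ℚ.≤-Reasoning

    inv-pos : ∀ {ε} → 0ℚ < ε → 0ℚ < inv ε
    inv-pos {ε} 0<ε = ℚ.*-cancelˡ-<-nonNeg ε {{ℚ.nonNegative (ℚ.<⇒≤ 0<ε)}}
      (≡.subst₂ _<_ (≡.sym (ℚ.*-zeroʳ ε)) (≡.sym (*-inv ε (pos⇒≢0 0<ε))) (ℚ.positive⁻¹ 1ℚ))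

    -- A δ with B δ = ε.
    shrink : ∀ {B ε} → 0ℚ < B → 0ℚ < ε →
      ∃[ δ ] 0ℚ < δ × (∀ a b → ∣ a ∣ ≤ B → ∣ b ∣ < δ → ∣ a * b ∣ < ε)
    shrink {B} {ε} 0<B 0<ε = ε * inv B , *-pos 0<ε (inv-pos 0<B) , λ a b p q → begin-strict
      ∣ a * b ∣         ≤⟨ ∣∣-*-mono {a} {b} p ℚ.≤-refl ⟩
      B * ∣ b ∣         <⟨ ℚ.*-monoʳ-<-pos B {{ℚ.positive 0<B}} q ⟩
      B * (ε * inv B)   ≡⟨ rearrange B ε (inv B) ⟩
      ε * (B * inv B)   ≡⟨ ≡.cong (ε *_) (*-inv B (pos⇒≢0 0<B)) ⟩
      ε * 1ℚ            ≡⟨ ℚ.*-identityʳ ε ⟩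
      ε                 ∎
      where
      open ℚ.≤-Reasoning
      rearrange : ∀ a b c → a * (b * c) ≡ b * (a * c)
      rearrange = solve 3 (λ a b c → a :* (b :* c) := b :* (a :* c)) ≡.refl
        where open +-*-Solver

    cauchy⇒bounded : ∀ s → Cauchy s → Bounded s
    cauchy⇒bounded s c with c 1ℚ (ℚ.positive⁻¹ 1ℚ)
    ... | N , h = ∣ s N ∣ + 1ℚ
                , ℚ.+-mono-≤-< (ℚ.0≤∣p∣ (s N)) (ℚ.positive⁻¹ 1ℚ)
                , N , λ n N≤n → begin
        ∣ s n ∣                   ≡⟨ ≡.cong ∣_∣ (split (s n) (s N)) ⟩
        ∣ s N + (s n - s N) ∣     ≤⟨ ℚ.∣p+q∣≤∣p∣+∣q∣ (s N) (s n - s N) ⟩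
        ∣ s N ∣ + ∣ s n - s N ∣   ≤⟨ ℚ.+-monoʳ-≤ ∣ s N ∣ (ℚ.<⇒≤ (h n N N≤n ℕ.≤-refl)) ⟩
        ∣ s N ∣ + 1ℚ              ∎
      where
      open ℚ.≤-Reasoning
      split : ∀ a b → a ≡ b + (a - b)
      split = solve 2 (λ a b → a := b :+ (a :- b)) ≡.refl
        where open +-*-Solver

  opaque

    null-cong : ∀ {s} t → (∀ n → s n ≡ t n) → Null t → Null s
    null-cong t e h ε 0<ε = ev-map (λ n → ≡.subst (λ q → ∣ q ∣ < ε) (≡.sym (e n))) (h ε 0<ε)

    null-0 : Null λ _ → 0ℚ
    null-0 ε 0<ε = 0 , λ _ _ → 0<ε

    null-+ : ∀ s t → Null s → Null t → Null λ n → s n + t n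
    null-+ s t p q ε 0<ε = ev-zip (λ n → ∣+∣< (s n) (t n))
      (p (½ * ε) (half-pos 0<ε)) (q (½ * ε) (half-pos 0<ε))

    null-neg : ∀ s → Null s → Null λ n → - s n
    null-neg s p ε 0<ε =
      ev-map (λ n → ≡.subst (_< ε) (≡.sym (ℚ.∣-p∣≡∣p∣ (s n)))) (p ε 0<ε)

    null-* : ∀ s t → Bounded s → Null t → Null λ n → s n * t n
    null-* s t (B , 0<B , b) q ε 0<ε with shrink 0<B 0<ε
    ... | δ , 0<δ , f = ev-zip (λ n → f (s n) (t n)) b (q δ 0<δ)

    away-cong : ∀ {s} t → (∀ n → s n ≡ t n) → Away t → Away s
    away-cong t e (ε , 0<ε , h) =
      ε , 0<ε , ev-map (λ n → ≡.subst (λ q → ε ≤ ∣ q ∣) (≡.sym (e n))) h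

    away-neg : ∀ {s} t → (∀ n → s n ≡ - t n) → Away t → Away s
    away-neg t e (ε , 0<ε , h) = ε , 0<ε , ev-map
      (λ n → ≡.subst (ε ≤_) (≡.sym (≡.trans (≡.cong ∣_∣ (e n)) (ℚ.∣-p∣≡∣p∣ (t n))))) h

    away-1 : Away λ _ → 1ℚ
    away-1 = 1ℚ , ℚ.positive⁻¹ 1ℚ , 0 , λ _ _ → ℚ.≤-refl

    null-away : ∀ s → Null s → Away s → ⊥
    null-away s p (ε , 0<ε , h) with ev-zip {R = λ _ → ⊥}
      (λ n a b → ℚ.<-irrefl ≡.refl (ℚ.<-≤-trans a b)) (p ε 0<ε) h
    ... | N , f = f N ℕ.≤-refl

    -- If s t is bounded away from 0 and t is bounded, s is bounded away
    -- from 0.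
    away-*⁻ : ∀ s t → Bounded t → Away (λ n → s n * t n) → Away s
    away-*⁻ s t (B , 0<B , b) (ε , 0<ε , h) with shrink 0<B 0<ε
    ... | δ , 0<δ , f = δ , 0<δ , ev-zip step b h
      where
      step : ∀ n → ∣ t n ∣ ≤ B → ε ≤ ∣ s n * t n ∣ → δ ≤ ∣ s n ∣
      step n t≤B ε≤ with δ ℚ.≤? ∣ s n ∣
      ... | yes δ≤ = δ≤
      ... | no  δ≰ = ⊥-elim (ℚ.<-irrefl ≡.refl (ℚ.<-≤-trans
        (≡.subst (λ q → ∣ q ∣ < ε) (ℚ.*-comm (t n) (s n)) (f (t n) (s n) t≤B (ℚ.≰⇒> δ≰))) ε≤))

    away-+-null : ∀ s t → Away (λ n → s n + t n) → Null t → Away s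
    away-+-null s t (ε , 0<ε , h) q = ½ * ε , half-pos 0<ε ,
      ev-zip (λ n → away-shift (s n) (t n)) h (q (½ * ε) (half-pos 0<ε))


    -- A Cauchy sequence with a large enough term far out is bounded
    -- away from 0.
    away-from : ∀ s ε → 0ℚ < ε → ∀ N →
      (∀ m n → N ℕ.≤ m → N ℕ.≤ n → ∣ s m - s n ∣ < ½ * ε) → ε ≤ ∣ s N ∣ → Away s
    away-from s ε 0<ε N h ε≤ = ½ * ε , half-pos 0<ε , N , λ n N≤n →
      away-shift (s n) (s N - s n)
        (≡.subst (λ q → ε ≤ ∣ q ∣) (split (s N) (s n)) ε≤) (h N n ℕ.≤-refl N≤n)
      where
      split : ∀ a b → a ≡ b + (a - b)
      split = solve 2 (λ a b → a := b :+ (a :- b)) ≡.refl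
        where open +-*-Solver

    ∣∣-cong< : ∀ {a b ε} → a ≡ b → ∣ b ∣ < ε → ∣ a ∣ < ε
    ∣∣-cong< ≡.refl h = h

    away-or : ∀ s t → Cauchy s → Cauchy t → Away (λ n → s n + t n) → Away s ⊎ Away t
    away-or s t cs ct (ε , 0<ε , K , h)
      with cs (½ * (½ * ε)) (half-pos (half-pos 0<ε)) | ct (½ * (½ * ε)) (half-pos (half-pos 0<ε))
    ... | M , f | N , g = result
      where
      L : ℕ
      L = (M ℕ.⊔ N) ℕ.⊔ K
      MN≤L : M ℕ.⊔ N ℕ.≤ L
      MN≤L = ℕ.m≤m⊔n (M ℕ.⊔ N) K
      M≤L : M ℕ.≤ L
      M≤L = ℕ.≤-trans (ℕ.m≤m⊔n M N) MN≤L
      N≤L : N ℕ.≤ L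
      N≤L = ℕ.≤-trans (ℕ.m≤n⊔m M N) MN≤L
      result : Away s ⊎ Away t
      result with ½ * ε ℚ.≤? ∣ t L ∣
      ... | yes p = inj₂ (away-from t (½ * ε) (half-pos 0<ε) L
        (λ m n a b → g m n (ℕ.≤-trans N≤L a) (ℕ.≤-trans N≤L b)) p)
      ... | no  p = inj₁ (away-from s (½ * ε) (half-pos 0<ε) L
        (λ m n a b → f m n (ℕ.≤-trans M≤L a) (ℕ.≤-trans M≤L b))
        (away-shift (s L) (t L) (h L (ℕ.m≤n⊔m (M ℕ.⊔ N) K)) (ℚ.≰⇒> p)))

    ¬away⇒null : ∀ s → Cauchy s → ¬ Away s → Null s
    ¬away⇒null s c ¬a ε 0<ε with c (½ * (½ * ε)) (half-pos (half-pos 0<ε))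
    ... | N , h with ½ * ε ℚ.≤? ∣ s N ∣
    ...   | yes p = ⊥-elim (¬a (away-from s (½ * ε) (half-pos 0<ε) N h p))
    ...   | no  p = N , λ n N≤n → ∣∣-cong< (split (s n) (s N))
      (∣+∣< (s N) (s n - s N) (ℚ.≰⇒> p) (ℚ.<-trans (h n N N≤n ℕ.≤-refl) quarter))
      where
      split : ∀ a b → a ≡ b + (a - b)
      split = solve 2 (λ a b → a := b :+ (a :- b)) ≡.refl
        where open +-*-Solver
      quarter : ½ * (½ * ε) < ½ * ε
      quarter = ≡.subst₂ _<_ (ℚ.+-identityʳ (½ * (½ * ε))) (halves (½ * ε))
        (ℚ.+-monoʳ-< (½ * (½ * ε)) (half-pos (half-pos 0<ε)))

    cauchy-const : ∀ q → Cauchy λ _ → q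
    cauchy-const q ε 0<ε = 0 , λ _ _ _ _ → ∣∣-cong< (ℚ.+-inverseʳ q) 0<ε

    cauchy-+ : ∀ s t → Cauchy s → Cauchy t → Cauchy λ n → s n + t n
    cauchy-+ s t p q ε 0<ε with p (½ * ε) (half-pos 0<ε) | q (½ * ε) (half-pos 0<ε)
    ... | M , f | N , g = M ℕ.⊔ N , λ m n a b →
      ∣∣-cong< (split (s m) (t m) (s n) (t n))
        (∣+∣< (s m - s n) (t m - t n)
          (f m n (ℕ.m⊔n≤o⇒m≤o M N a) (ℕ.m⊔n≤o⇒m≤o M N b))
          (g m n (ℕ.m⊔n≤o⇒n≤o M N a) (ℕ.m⊔n≤o⇒n≤o M N b)))
      where
      split : ∀ a b c d → (a + b) - (c + d) ≡ (a - c) + (b - d)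
      split = solve 4 (λ a b c d → (a :+ b) :- (c :+ d) := (a :- c) :+ (b :- d)) ≡.refl
        where open +-*-Solver

    cauchy-neg : ∀ s → Cauchy s → Cauchy λ n → - s n
    cauchy-neg s p ε 0<ε with p ε 0<ε
    ... | N , f = N , λ m n a b → ∣∣-cong< (swap (s m) (s n)) (f n m b a)
      where
      swap : ∀ a b → (- a) - (- b) ≡ b - a
      swap = solve 2 (λ a b → (:- a) :- (:- b) := b :- a) ≡.refl
        where open +-*-Solver

    cauchy-* : ∀ s t → Cauchy s → Cauchy t → Cauchy λ n → s n * t n
    cauchy-* s t p q ε 0<ε with cauchy⇒bounded s p | cauchy⇒bounded t q
    ... | A , 0<A , K , a | B , 0<B , L , b
      with shrink 0<A (half-pos 0<ε) | shrink 0<B (half-pos 0<ε)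
    ... | δ , 0<δ , f | γ , 0<γ , g with p γ 0<γ | q δ 0<δ
    ... | M , h | N , k = (K ℕ.⊔ L) ℕ.⊔ (M ℕ.⊔ N) , λ m n u v →
      ∣∣-cong< (split (s m) (t m) (s n) (t n))
        (∣+∣< (s m * (t m - t n)) (t n * (s m - s n))
          (f _ _ (a m (ℕ.m⊔n≤o⇒m≤o K L (ℕ.m⊔n≤o⇒m≤o (K ℕ.⊔ L) (M ℕ.⊔ N) u)))
                 (k m n (ℕ.m⊔n≤o⇒n≤o M N (ℕ.m⊔n≤o⇒n≤o (K ℕ.⊔ L) (M ℕ.⊔ N) u))
                        (ℕ.m⊔n≤o⇒n≤o M N (ℕ.m⊔n≤o⇒n≤o (K ℕ.⊔ L) (M ℕ.⊔ N) v))))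
          (g _ _ (b n (ℕ.m⊔n≤o⇒n≤o K L (ℕ.m⊔n≤o⇒m≤o (K ℕ.⊔ L) (M ℕ.⊔ N) v)))
                 (h m n (ℕ.m⊔n≤o⇒m≤o M N (ℕ.m⊔n≤o⇒n≤o (K ℕ.⊔ L) (M ℕ.⊔ N) u))
                        (ℕ.m⊔n≤o⇒m≤o M N (ℕ.m⊔n≤o⇒n≤o (K ℕ.⊔ L) (M ℕ.⊔ N) v)))))
      where
      split : ∀ a b c d → a * b - c * d ≡ a * (b - d) + d * (a - c)
      split = solve 4 (λ a b c d → a :* b :- c :* d := a :* (b :- d) :+ d :* (a :- c)) ≡.refl
        where open +-*-Solver

    cauchy-inv : ∀ s → Cauchy s → Away s → Cauchy (inv ∘ s)
    cauchy-inv s p (ε₀ , 0<ε₀ , K , away) ε 0<ε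
      with shrink (*-pos (inv-pos 0<ε₀) (inv-pos 0<ε₀)) 0<ε
    ... | δ , 0<δ , f with p δ 0<δ
    ... | M , h = K ℕ.⊔ M , λ m n u v →
      let am = away m (ℕ.m⊔n≤o⇒m≤o K M u)
          an = away n (ℕ.m⊔n≤o⇒m≤o K M v)
      in ∣∣-cong< (difference (s m) (s n) (away⇒≢0 0<ε₀ am) (away⇒≢0 0<ε₀ an))
           (f (inv (s m) * inv (s n)) (s n - s m)
              (∣∣-*-mono {inv (s m)} {inv (s n)} (∣inv∣≤ 0<ε₀ am) (∣inv∣≤ 0<ε₀ an))
              (h n m (ℕ.m⊔n≤o⇒n≤o K M v) (ℕ.m⊔n≤o⇒n≤o K M u)))
      where
      difference : ∀ a b → a ≢ 0ℚ → b ≢ 0ℚ → inv a - inv b ≡ (inv a * inv b) * (b - a)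
      difference a b a≢0 b≢0 = begin
        inv a - inv b                               ≡⟨ ≡.cong₂ _-_ (ℚ.*-identityˡ (inv a)) (ℚ.*-identityˡ (inv b)) ⟨
        1ℚ * inv a - 1ℚ * inv b                     ≡⟨ ≡.cong₂ (λ u v → u * inv a - v * inv b) (*-inv b b≢0) (*-inv a a≢0) ⟨
        (b * inv b) * inv a - (a * inv a) * inv b   ≡⟨ collect a b (inv a) (inv b) ⟩
        (inv a * inv b) * (b - a)                   ∎
        where
        open ≡.≡-Reasoning
        collect : ∀ a b c d → (b * d) * c - (a * c) * d ≡ (c * d) * (b - a)
        collect = solve 4 (λ a b c d → (b :* d) :* c :- (a :* c) :* d := (c :* d) :* (b :- a)) ≡.refl
          where open +-*-Solver

  infixl 6 _+ᴿ_
  infixl 7 _*ᴿ_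
  infix  8 -ᴿ_

  constᴿ : ℚ → ℝ
  constᴿ q = real (λ _ → q) (cauchy-const q)

  _+ᴿ_ _*ᴿ_ : ℝ → ℝ → ℝ
  real s p +ᴿ real t q = real (λ n → s n + t n) (cauchy-+ s t p q)
  real s p *ᴿ real t q = real (λ n → s n * t n) (cauchy-* s t p q)

  -ᴿ_ : ℝ → ℝ
  -ᴿ real s p = real (λ n → - s n) (cauchy-neg s p)

  recipᴿ : (x : ℝ) → Away (seq x) → ℝ
  recipᴿ (real s p) a = real (inv ∘ s) (cauchy-inv s p a)

  opaque

    recip-inverse : ∀ x a → Null λ n → seq x n * seq (recipᴿ x a) n - 1ℚ
    recip-inverse x (ε₀ , 0<ε₀ , K , away) ε 0<ε = K , λ n K≤n →
      ∣∣-cong< (≡.cong (_- 1ℚ) (*-inv (seq x n) (away⇒≢0 0<ε₀ (away n K≤n)))) 0<ε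

    away-sumsq : ∀ s t → Away s ⊎ Away t → Away λ n → s n * s n + t n * t n
    away-sumsq s t (inj₂ h) = away-cong (λ n → t n * t n + s n * s n)
      (λ n → ℚ.+-comm (s n * s n) (t n * t n)) (away-sumsq t s (inj₁ h))
    away-sumsq s t (inj₁ (ε , 0<ε , h)) = ε * ε , *-pos 0<ε 0<ε , ev-map step h
      where
      square-∣∣ : ∀ q → q * q ≡ ∣ q * q ∣
      square-∣∣ q with ℚ.∣p∣≡p∨∣p∣≡-p q
      ... | inj₁ e = ≡.trans (≡.sym (≡.cong₂ _*_ e e)) (≡.sym (ℚ.∣p*q∣≡∣p∣*∣q∣ q q))
      ... | inj₂ e = ≡.trans (neg-square q)
        (≡.trans (≡.sym (≡.cong₂ _*_ e e)) (≡.sym (ℚ.∣p*q∣≡∣p∣*∣q∣ q q)))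
        where
        neg-square : ∀ a → a * a ≡ (- a) * (- a)
        neg-square = solve 1 (λ a → a :* a := (:- a) :* (:- a)) ≡.refl
          where open +-*-Solver

      square-nonNeg : ∀ q → 0ℚ ≤ q * q
      square-nonNeg q = ≡.subst (0ℚ ≤_) (≡.sym (square-∣∣ q)) (ℚ.0≤∣p∣ (q * q))

      step : ∀ n → ε ≤ ∣ s n ∣ → ε * ε ≤ ∣ s n * s n + t n * t n ∣
      step n p = begin
        ε * ε                         ≤⟨ *-mono-away {s n} {s n} (ℚ.<⇒≤ 0<ε) p (ℚ.<⇒≤ 0<ε) p ⟩
        ∣ s n * s n ∣                 ≡⟨ square-∣∣ (s n) ⟨
        s n * s n                     ≡⟨ ℚ.+-identityʳ (s n * s n) ⟨
        s n * s n + 0ℚ                ≤⟨ ℚ.+-monoʳ-≤ (s n * s n) (square-nonNeg (t n)) ⟩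
        s n * s n + t n * t n         ≡⟨ ℚ.0≤p⇒∣p∣≡p (ℚ.+-mono-≤ (square-nonNeg (s n)) (square-nonNeg (t n))) ⟨
        ∣ s n * s n + t n * t n ∣     ∎
        where open ℚ.≤-Reasoning

------------------------------------------------------------------------
-- Complex numbers, as pairs of reals.

module Complex where

  open Real
  open import Data.Rational.Base using (_+_; _*_; _-_; -_; _<_; _≤_)
  open +-*-Solver using (solve; con; _:=_; _:+_; _:*_; _:-_; :-_)

  record ℂ : Set where
    constructor _+i_
    field
      re im : ℝ

  open ℂ public

  infix 4 _≈ᶜ_ _#ᶜ_

  record _≈ᶜ_ (z w : ℂ) : Set where
    constructor _,_
    field
      re≈ : re z ≈ᴿ re w
      im≈ : im z ≈ᴿ im w

  open _≈ᶜ_ public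

  data _#ᶜ_ (z w : ℂ) : Set where
    re# : re z #ᴿ re w → z #ᶜ w
    im# : im z #ᴿ im w → z #ᶜ w

  infixl 6 _+ᶜ_
  infixl 7 _*ᶜ_
  infix  8 -ᶜ_

  _+ᶜ_ _*ᶜ_ : ℂ → ℂ → ℂ
  (a +i b) +ᶜ (c +i d) = (a +ᴿ c) +i (b +ᴿ d)
  (a +i b) *ᶜ (c +i d) = (a *ᴿ c +ᴿ -ᴿ (b *ᴿ d)) +i (a *ᴿ d +ᴿ b *ᴿ c)

  -ᶜ_ : ℂ → ℂ
  -ᶜ (a +i b) = (-ᴿ a) +i (-ᴿ b)

  0ᶜ 1ᶜ : ℂ
  0ᶜ = constᴿ 0ℚ +i constᴿ 0ℚ
  1ᶜ = constᴿ 1ℚ +i constᴿ 0ℚ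

  private

    infix 9 _ʳ_ _ⁱ_
    _ʳ_ _ⁱ_ : ℂ → ℕ → ℚ
    z ʳ n = seq (re z) n
    z ⁱ n = seq (im z) n

  opaque

    pointwise : ∀ {z w} → (∀ n → z ʳ n ≡ w ʳ n) → (∀ n → z ⁱ n ≡ w ⁱ n) → z ≈ᶜ w
    pointwise {z} {w} p q = zero-diff p , zero-diff q
      where
      zero-diff : ∀ {s t : ℕ → ℚ} → (∀ n → s n ≡ t n) → Null λ n → s n - t n
      zero-diff {s} {t} e = null-cong (λ _ → 0ℚ)
        (λ n → ≡.trans (≡.cong (_- t n) (e n)) (ℚ.+-inverseʳ (t n))) null-0

    ≈-refl : ∀ {z} → z ≈ᶜ z
    ≈-refl = pointwise (λ _ → ≡.refl) (λ _ → ≡.refl)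

    ≈-sym : ∀ {z w} → z ≈ᶜ w → w ≈ᶜ z
    ≈-sym {z} {w} (p , q) = flip (z ʳ_) (w ʳ_) p , flip (z ⁱ_) (w ⁱ_) q
      where
      flip : ∀ (s t : ℕ → ℚ) → Null (λ n → s n - t n) → Null (λ n → t n - s n)
      flip s t h = null-cong (λ n → - (s n - t n)) (λ n → swap (t n) (s n))
        (null-neg (λ n → s n - t n) h)
        where
        swap : ∀ a b → a - b ≡ - (b - a)
        swap = solve 2 (λ a b → a :- b := :- (b :- a)) ≡.refl

    ≈-trans : ∀ {z w v} → z ≈ᶜ w → w ≈ᶜ v → z ≈ᶜ v
    ≈-trans {z} {w} {v} (p , q) (r , s) =
      chain (z ʳ_) (w ʳ_) (v ʳ_) p r , chain (z ⁱ_) (w ⁱ_) (v ⁱ_) q s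
      where
      chain : ∀ (s t u : ℕ → ℚ) → Null (λ n → s n - t n) → Null (λ n → t n - u n) → Null (λ n → s n - u n)
      chain s t u h k = null-cong (λ n → (s n - t n) + (t n - u n))
        (λ n → split (s n) (t n) (u n)) (null-+ (λ n → s n - t n) (λ n → t n - u n) h k)
        where
        split : ∀ a b c → a - c ≡ (a - b) + (b - c)
        split = solve 3 (λ a b c → a :- c := (a :- b) :+ (b :- c)) ≡.refl

    +-cong : ∀ {z z′ w w′} → z ≈ᶜ z′ → w ≈ᶜ w′ → z +ᶜ w ≈ᶜ z′ +ᶜ w′
    +-cong {z} {z′} {w} {w′} (p , q) (r , s) =
      add (z ʳ_) (z′ ʳ_) (w ʳ_) (w′ ʳ_) p r , add (z ⁱ_) (z′ ⁱ_) (w ⁱ_) (w′ ⁱ_) q s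
      where
      add : ∀ (s s′ t t′ : ℕ → ℚ) → Null (λ n → s n - s′ n) → Null (λ n → t n - t′ n) →
            Null (λ n → (s n + t n) - (s′ n + t′ n))
      add s s′ t t′ h k = null-cong (λ n → (s n - s′ n) + (t n - t′ n))
        (λ n → split (s n) (t n) (s′ n) (t′ n))
        (null-+ (λ n → s n - s′ n) (λ n → t n - t′ n) h k)
        where
        split : ∀ a b c d → (a + b) - (c + d) ≡ (a - c) + (b - d)
        split = solve 4 (λ a b c d → (a :+ b) :- (c :+ d) := (a :- c) :+ (b :- d)) ≡.refl

    neg-cong : ∀ {z w} → z ≈ᶜ w → -ᶜ z ≈ᶜ -ᶜ w
    neg-cong {z} {w} (p , q) = neg (z ʳ_) (w ʳ_) p , neg (z ⁱ_) (w ⁱ_) q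
      where
      neg : ∀ (s t : ℕ → ℚ) → Null (λ n → s n - t n) → Null (λ n → (- s n) - (- t n))
      neg s t h = null-cong (λ n → - (s n - t n)) (λ n → split (s n) (t n))
        (null-neg (λ n → s n - t n) h)
        where
        split : ∀ a b → (- a) - (- b) ≡ - (a - b)
        split = solve 2 (λ a b → (:- a) :- (:- b) := :- (a :- b)) ≡.refl

    *-cong : ∀ {z z′ w w′} → z ≈ᶜ z′ → w ≈ᶜ w′ → z *ᶜ w ≈ᶜ z′ *ᶜ w′
    *-cong {z} {z′} {w} {w′} (p , q) (r , s) =
      null-cong (λ n → (z ʳ n * w ʳ n - z′ ʳ n * w′ ʳ n) + - (z ⁱ n * w ⁱ n - z′ ⁱ n * w′ ⁱ n))
        (λ n → split⁻ (z ʳ n * w ʳ n) (z ⁱ n * w ⁱ n) (z′ ʳ n * w′ ʳ n) (z′ ⁱ n * w′ ⁱ n))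
        (null-+ (λ n → z ʳ n * w ʳ n - z′ ʳ n * w′ ʳ n) (λ n → - (z ⁱ n * w ⁱ n - z′ ⁱ n * w′ ⁱ n))
          (mul (re z) (re z′) (re w) (re w′) p r)
          (null-neg (λ n → z ⁱ n * w ⁱ n - z′ ⁱ n * w′ ⁱ n) (mul (im z) (im z′) (im w) (im w′) q s)))
      , null-cong (λ n → (z ʳ n * w ⁱ n - z′ ʳ n * w′ ⁱ n) + (z ⁱ n * w ʳ n - z′ ⁱ n * w′ ʳ n))
        (λ n → split⁺ (z ʳ n * w ⁱ n) (z ⁱ n * w ʳ n) (z′ ʳ n * w′ ⁱ n) (z′ ⁱ n * w′ ʳ n))
        (null-+ (λ n → z ʳ n * w ⁱ n - z′ ʳ n * w′ ⁱ n) (λ n → z ⁱ n * w ʳ n - z′ ⁱ n * w′ ʳ n)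
          (mul (re z) (re z′) (im w) (im w′) p s)
          (mul (im z) (im z′) (re w) (re w′) q r))
      where
      split⁻ : ∀ a b c d → (a + - b) - (c + - d) ≡ (a - c) + - (b - d)
      split⁻ = solve 4 (λ a b c d → (a :+ :- b) :- (c :+ :- d) := (a :- c) :+ :- (b :- d)) ≡.refl
      split⁺ : ∀ a b c d → (a + b) - (c + d) ≡ (a - c) + (b - d)
      split⁺ = solve 4 (λ a b c d → (a :+ b) :- (c :+ d) := (a :- c) :+ (b :- d)) ≡.refl
      mul : ∀ x x′ y y′ → x ≈ᴿ x′ → y ≈ᴿ y′ →
            Null (λ n → seq x n * seq y n - seq x′ n * seq y′ n)
      mul x x′ y y′ h k = null-cong
        (λ n → seq x n * (seq y n - seq y′ n) + seq y′ n * (seq x n - seq x′ n))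
        (λ n → split (seq x n) (seq y n) (seq x′ n) (seq y′ n))
        (null-+ (λ n → seq x n * (seq y n - seq y′ n)) (λ n → seq y′ n * (seq x n - seq x′ n))
          (null-* (seq x) (λ n → seq y n - seq y′ n) (cauchy⇒bounded (seq x) (cauchy x)) k)
          (null-* (seq y′) (λ n → seq x n - seq x′ n) (cauchy⇒bounded (seq y′) (cauchy y′)) h))
        where
        split : ∀ a b c d → a * b - c * d ≡ a * (b - d) + d * (a - c)
        split = solve 4 (λ a b c d → a :* b :- c :* d := a :* (b :- d) :+ d :* (a :- c)) ≡.refl

    +-assoc : ∀ z w v → (z +ᶜ w) +ᶜ v ≈ᶜ z +ᶜ (w +ᶜ v)
    +-assoc z w v = pointwise
      (λ n → ℚ.+-assoc (z ʳ n) (w ʳ n) (v ʳ n)) (λ n → ℚ.+-assoc (z ⁱ n) (w ⁱ n) (v ⁱ n))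

    +-comm : ∀ z w → z +ᶜ w ≈ᶜ w +ᶜ z
    +-comm z w = pointwise (λ n → ℚ.+-comm (z ʳ n) (w ʳ n)) (λ n → ℚ.+-comm (z ⁱ n) (w ⁱ n))

    +-identityˡ : ∀ z → 0ᶜ +ᶜ z ≈ᶜ z
    +-identityˡ z = pointwise (λ n → ℚ.+-identityˡ (z ʳ n)) (λ n → ℚ.+-identityˡ (z ⁱ n))

    +-inverseˡ : ∀ z → -ᶜ z +ᶜ z ≈ᶜ 0ᶜ
    +-inverseˡ z = pointwise (λ n → ℚ.+-inverseˡ (z ʳ n)) (λ n → ℚ.+-inverseˡ (z ⁱ n))

    *-assoc : ∀ z w v → (z *ᶜ w) *ᶜ v ≈ᶜ z *ᶜ (w *ᶜ v)
    *-assoc z w v = pointwise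
      (λ n → real-part (z ʳ n) (z ⁱ n) (w ʳ n) (w ⁱ n) (v ʳ n) (v ⁱ n))
      (λ n → imag-part (z ʳ n) (z ⁱ n) (w ʳ n) (w ⁱ n) (v ʳ n) (v ⁱ n))
      where
      real-part : ∀ a b c d e f →
        (a * c + - (b * d)) * e + - ((a * d + b * c) * f) ≡
        a * (c * e + - (d * f)) + - (b * (c * f + d * e))
      real-part = solve 6 (λ a b c d e f →
        (a :* c :+ :- (b :* d)) :* e :+ :- ((a :* d :+ b :* c) :* f) :=
        a :* (c :* e :+ :- (d :* f)) :+ :- (b :* (c :* f :+ d :* e))) ≡.refl
      imag-part : ∀ a b c d e f →
        (a * c + - (b * d)) * f + (a * d + b * c) * e ≡
        a * (c * f + d * e) + b * (c * e + - (d * f))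
      imag-part = solve 6 (λ a b c d e f →
        (a :* c :+ :- (b :* d)) :* f :+ (a :* d :+ b :* c) :* e :=
        a :* (c :* f :+ d :* e) :+ b :* (c :* e :+ :- (d :* f))) ≡.refl

    *-comm : ∀ z w → z *ᶜ w ≈ᶜ w *ᶜ z
    *-comm z w = pointwise
      (λ n → real-part (z ʳ n) (z ⁱ n) (w ʳ n) (w ⁱ n))
      (λ n → imag-part (z ʳ n) (z ⁱ n) (w ʳ n) (w ⁱ n))
      where
      real-part : ∀ a b c d → a * c + - (b * d) ≡ c * a + - (d * b)
      real-part = solve 4 (λ a b c d → a :* c :+ :- (b :* d) := c :* a :+ :- (d :* b)) ≡.refl
      imag-part : ∀ a b c d → a * d + b * c ≡ c * b + d * a
      imag-part = solve 4 (λ a b c d → a :* d :+ b :* c := c :* b :+ d :* a) ≡.refl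

    *-identityˡ : ∀ z → 1ᶜ *ᶜ z ≈ᶜ z
    *-identityˡ z = pointwise
      (λ n → real-part (z ʳ n) (z ⁱ n)) (λ n → imag-part (z ʳ n) (z ⁱ n))
      where
      real-part : ∀ a b → 1ℚ * a + - (0ℚ * b) ≡ a
      real-part = solve 2 (λ a b → con 1ℚ :* a :+ :- (con 0ℚ :* b) := a) ≡.refl
      imag-part : ∀ a b → 1ℚ * b + 0ℚ * a ≡ b
      imag-part = solve 2 (λ a b → con 1ℚ :* b :+ con 0ℚ :* a := b) ≡.refl

    *-distribʳ-+ : ∀ v z w → (z +ᶜ w) *ᶜ v ≈ᶜ z *ᶜ v +ᶜ w *ᶜ v
    *-distribʳ-+ v z w = pointwise
      (λ n → real-part (z ʳ n) (z ⁱ n) (w ʳ n) (w ⁱ n) (v ʳ n) (v ⁱ n))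
      (λ n → imag-part (z ʳ n) (z ⁱ n) (w ʳ n) (w ⁱ n) (v ʳ n) (v ⁱ n))
      where
      real-part : ∀ a b c d e f → (a + c) * e + - ((b + d) * f) ≡
        (a * e + - (b * f)) + (c * e + - (d * f))
      real-part = solve 6 (λ a b c d e f → (a :+ c) :* e :+ :- ((b :+ d) :* f) :=
        (a :* e :+ :- (b :* f)) :+ (c :* e :+ :- (d :* f))) ≡.refl
      imag-part : ∀ a b c d e f → (a + c) * f + (b + d) * e ≡
        (a * f + b * e) + (c * f + d * e)
      imag-part = solve 6 (λ a b c d e f → (a :+ c) :* f :+ (b :+ d) :* e :=
        (a :* f :+ b :* e) :+ (c :* f :+ d :* e)) ≡.refl

  commutativeRing : CommutativeRing 0ℓ 0ℓ
  commutativeRing = record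
    { Carrier = ℂ ; _≈_ = _≈ᶜ_ ; _+_ = _+ᶜ_ ; _*_ = _*ᶜ_ ; -_ = -ᶜ_ ; 0# = 0ᶜ ; 1# = 1ᶜ
    ; isCommutativeRing = record
      { isRing = record
        { +-isAbelianGroup = record
          { isGroup = record
            { isMonoid = record
              { isSemigroup = record
                { isMagma = record
                  { isEquivalence = Setoid.isEquivalence ≈-setoid
                  ; ∙-cong = +-cong
                  }
                ; assoc = +-assoc
                }
              ; identity = comm∧idˡ⇒id +-comm +-identityˡ
              }
            ; inverse = comm∧invˡ⇒inv +-comm +-inverseˡ
            ; ⁻¹-cong = neg-cong
            }
          ; comm = +-comm
          }
        ; *-cong = *-cong
        ; *-assoc = *-assoc
        ; *-identity = comm∧idˡ⇒id *-comm *-identityˡ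
        ; distrib = comm∧distrʳ⇒distr +-cong *-comm *-distribʳ-+
        }
      ; *-comm = *-comm
      }
    }
    where
    ≈-setoid : Setoid 0ℓ 0ℓ
    ≈-setoid = record
      { Carrier = ℂ ; _≈_ = _≈ᶜ_
      ; isEquivalence = record { refl = ≈-refl ; sym = ≈-sym ; trans = ≈-trans }
      }
    open import Algebra.Consequences.Setoid ≈-setoid
      using (comm∧idˡ⇒id; comm∧invˡ⇒inv; comm∧distrʳ⇒distr)

  open CommutativeRing commutativeRing using (isCommutativeRing)

  opaque

    cauchy-diff : ∀ x y → Cauchy λ n → seq x n - seq y n
    cauchy-diff x y = cauchy-+ (seq x) (λ n → - seq y n) (cauchy x) (cauchy-neg (seq y) (cauchy y))

    #ᴿ-sym : ∀ x y → x #ᴿ y → y #ᴿ x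
    #ᴿ-sym x y h = away-neg (λ n → seq x n - seq y n) (λ n → swap (seq y n) (seq x n)) h
      where
      swap : ∀ a b → a - b ≡ - (b - a)
      swap = solve 2 (λ a b → a :- b := :- (b :- a)) ≡.refl

    #ᴿ-cotrans : ∀ x y z → x #ᴿ y → x #ᴿ z ⊎ z #ᴿ y
    #ᴿ-cotrans x y z h = away-or (λ n → seq x n - seq z n) (λ n → seq z n - seq y n)
      (cauchy-diff x z) (cauchy-diff z y)
      (away-cong (λ n → seq x n - seq y n) (λ n → split (seq x n) (seq z n) (seq y n)) h)
      where
      split : ∀ a b c → (a - b) + (b - c) ≡ a - c
      split = solve 3 (λ a b c → (a :- b) :+ (b :- c) := a :- c) ≡.refl

    #-irrefl : ∀ {z w} → z ≈ᶜ w → ¬ z #ᶜ w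
    #-irrefl {z} {w} (p , q) (re# h) = null-away (λ n → z ʳ n - w ʳ n) p h
    #-irrefl {z} {w} (p , q) (im# h) = null-away (λ n → z ⁱ n - w ⁱ n) q h

    #-sym : ∀ {z w} → z #ᶜ w → w #ᶜ z
    #-sym {z} {w} (re# h) = re# (#ᴿ-sym (re z) (re w) h)
    #-sym {z} {w} (im# h) = im# (#ᴿ-sym (im z) (im w) h)

    #-cotrans : ∀ {z w} → z #ᶜ w → ∀ v → z #ᶜ v ⊎ v #ᶜ w
    #-cotrans {z} {w} (re# h) v = ⊎.map re# re# (#ᴿ-cotrans (re z) (re w) (re v) h)
    #-cotrans {z} {w} (im# h) v = ⊎.map im# im# (#ᴿ-cotrans (im z) (im w) (im v) h)

    #-tight : ∀ z w → ¬ z #ᶜ w → z ≈ᶜ w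
    #-tight z w h =
        ¬away⇒null (λ n → z ʳ n - w ʳ n) (cauchy-diff (re z) (re w)) (h ∘ re#)
      , ¬away⇒null (λ n → z ⁱ n - w ⁱ n) (cauchy-diff (im z) (im w)) (h ∘ im#)

    normSq-away : ∀ z w → z #ᶜ w → let v = z +ᶜ -ᶜ w in
      Away λ n → v ʳ n * v ʳ n + v ⁱ n * v ⁱ n
    normSq-away z w (re# h) = away-sumsq (λ n → z ʳ n - w ʳ n) (λ n → z ⁱ n - w ⁱ n) (inj₁ h)
    normSq-away z w (im# h) = away-sumsq (λ n → z ʳ n - w ʳ n) (λ n → z ⁱ n - w ⁱ n) (inj₂ h)

  normSq : ℂ → ℝ
  normSq (a +i b) = a *ᴿ a +ᴿ b *ᴿ b

  -- (a + bi)⁻¹ = (a - bi) / (a² + b²)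
  recipᶜ : (z : ℂ) → Away (seq (normSq z)) → ℂ
  recipᶜ z@(a +i b) h = let r = recipᴿ (normSq z) h in (a *ᴿ r) +i (-ᴿ (b *ᴿ r))

  opaque

    *-recip : ∀ z h → z *ᶜ recipᶜ z h ≈ᶜ 1ᶜ
    *-recip z h =
        null-cong (λ n → N n * r n - 1ℚ) (λ n → real-part (z ʳ n) (z ⁱ n) (r n))
          (recip-inverse (normSq z) h)
      , null-cong (λ _ → 0ℚ) (λ n → imag-part (z ʳ n) (z ⁱ n) (r n)) null-0
      where
      N r : ℕ → ℚ
      N = seq (normSq z)
      r = seq (recipᴿ (normSq z) h)
      real-part : ∀ a b r → (a * (a * r) + - (b * - (b * r))) - 1ℚ ≡ (a * a + b * b) * r - 1ℚ
      real-part = solve 3 (λ a b r →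
        (a :* (a :* r) :+ :- (b :* :- (b :* r))) :- con 1ℚ := (a :* a :+ b :* b) :* r :- con 1ℚ) ≡.refl
      imag-part : ∀ a b r → (a * - (b * r) + b * (a * r)) - 0ℚ ≡ 0ℚ
      imag-part = solve 3 (λ a b r → (a :* :- (b :* r) :+ b :* (a :* r)) :- con 0ℚ := con 0ℚ) ≡.refl

    -- Re(vu) = Re v Re u - Im v Im u is close to 1, so one of the two
    -- products is away from 0.
    right-invertible⇒# : ∀ z w u → (z +ᶜ -ᶜ w) *ᶜ u ≈ᶜ 1ᶜ → z #ᶜ w
    right-invertible⇒# z w u p = ⊎.[ re# ∘ from-re , im# ∘ from-im ]
      (away-or ac bd′ (cauchy (re v *ᴿ re u)) (cauchy (-ᴿ (im v *ᴿ im u)))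
        (away-+-null (λ n → ac n + bd′ n) (λ n → - (ac n + bd′ n - 1ℚ))
          (away-cong (λ _ → 1ℚ) (λ n → cancel (ac n + bd′ n)) away-1)
          (null-neg (λ n → ac n + bd′ n - 1ℚ) (re≈ p))))
      where
      v : ℂ
      v = z +ᶜ -ᶜ w
      ac bd′ : ℕ → ℚ
      ac n = v ʳ n * u ʳ n
      bd′ n = - (v ⁱ n * u ⁱ n)
      cancel : ∀ a → a + - (a - 1ℚ) ≡ 1ℚ
      cancel = solve 1 (λ a → a :+ :- (a :- con 1ℚ) := con 1ℚ) ≡.refl
      neg-neg : ∀ a → a ≡ - (- a)
      neg-neg = solve 1 (λ a → a := :- (:- a)) ≡.refl
      from-re : Away ac → re z #ᴿ re w
      from-re = away-*⁻ (v ʳ_) (u ʳ_) (cauchy⇒bounded (u ʳ_) (cauchy (re u)))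
      from-im : Away bd′ → im z #ᴿ im w
      from-im h = away-*⁻ (v ⁱ_) (u ⁱ_) (cauchy⇒bounded (u ⁱ_) (cauchy (im u)))
        (away-neg bd′ (λ n → neg-neg (v ⁱ n * u ⁱ n)) h)

  heytingField : HeytingField 0ℓ 0ℓ 0ℓ
  heytingField = record
    { Carrier = ℂ ; _≈_ = _≈ᶜ_ ; _#_ = _#ᶜ_ ; _+_ = _+ᶜ_ ; _*_ = _*ᶜ_ ; -_ = -ᶜ_ ; 0# = 0ᶜ ; 1# = 1ᶜ
    ; isHeytingField = record
      { isHeytingCommutativeRing = record
        { isCommutativeRing = isCommutativeRing
        ; isApartnessRelation = record
          { irrefl = #-irrefl ; sym = #-sym ; cotrans = #-cotrans }
        ; #⇒invertible = λ {z} {w} z#w →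
            let v = z +ᶜ -ᶜ w ; h = normSq-away z w z#w in
            recipᶜ v h , ≈-trans (*-comm (recipᶜ v h) v) (*-recip v h) , *-recip v h
        ; invertible⇒# = λ {z} {w} (u , _ , vu≈1) → right-invertible⇒# z w u vu≈1
        }
      ; tight = λ z w → #-tight z w , #-irrefl
      }
    }

  opaque

    characteristicZero : ∀ n → fromℕ heytingField (suc n) #ᶜ 0ᶜ
    characteristicZero n = re# (1ℚ , ℚ.positive⁻¹ 1ℚ , 0 , λ k _ → bound k)
      where
      0≤re : ∀ m k → 0ℚ ≤ fromℕ heytingField m ʳ k
      0≤re zero    k = ℚ.≤-refl
      0≤re (suc m) k = ℚ.+-mono-≤ (ℚ.nonNegative⁻¹ 1ℚ) (0≤re m k)

      bound : ∀ k → 1ℚ ≤ ∣ fromℕ heytingField (suc n) ʳ k - 0ℚ ∣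
      bound k = begin
        1ℚ                                             ≡⟨ ℚ.+-identityʳ 1ℚ ⟨
        1ℚ + 0ℚ                                        ≤⟨ ℚ.+-monoʳ-≤ 1ℚ (0≤re n k) ⟩
        1ℚ + fromℕ heytingField n ʳ k                  ≡⟨ ℚ.0≤p⇒∣p∣≡p (0≤re (suc n) k) ⟨
        ∣ 1ℚ + fromℕ heytingField n ʳ k ∣              ≡⟨ ≡.cong ∣_∣ (ℚ.+-identityʳ _) ⟨
        ∣ fromℕ heytingField (suc n) ʳ k - 0ℚ ∣        ∎
        where open ℚ.≤-Reasoning

open Complex public using (ℂ)
open HeytingField Complex.heytingField public
  using (_≈_; _#_; _+_; _*_; -_; _-_; 0#; 1#)
open CharacteristicZero Complex.heytingField Complex.characteristicZero public

{-# OPTIONS --safe #-}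
module Submission where

-- Saalschütz's summation, with denominators cleared and x = d + y, reads
--   ∑ₖ (-1)ᵏ C(n,k) (y)ₖ (2d+y+n+1)ₖ ∏_{k<i≤n} ((x+i)² + σ) = ∏_{i≤n} ((d+i)² + σ),
-- a polynomial identity that holds in every commutative ring and follows by
-- induction on n from Pascal's rule and the relation
--   (x+k+1)² + n(y+k) = (d+1)² + (y+k)(2d+y+n+2+k).
-- Taking σ to be the ε of the dual numbers differentiates it at σ = 0, and the
-- logarithmic derivative of ∏_{i≤n} ((a+i)² + σ) there is H 2 n a.

open import Algebra.Apartness.Bundles using (HeytingCommutativeRing; HeytingField)
open import Algebra.Bundles using (CommutativeRing)
import Algebra.Apartness.Properties.HeytingCommutativeRing as HeytingProperties
import Algebra.Module.Construct.Idealization as Idealization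
import Algebra.Module.Construct.TensorUnit as TensorUnit
import Algebra.Properties.Ring as RingProperties
import Algebra.Properties.Semiring.Mult as Mult
import Algebra.Properties.Semiring.Sum as Sum
import Algebra.Solver.Ring.NaturalCoefficients.Default as Solver
open import Data.Fin.Base using (toℕ)
open import Data.Fin.Properties using (toℕ≤pred[n])
open import Data.Nat.Base as ℕ using (ℕ; zero; suc; z≤n; s≤s; NonZero; _∸_; _!)
import Data.Nat.Properties as ℕ
open import Data.Product.Base using (_,_; proj₁; proj₂)
open import Defs using (fromℕ; module CharacteristicZero)
open import Level as Level using (_⊔_)
import Relation.Binary.PropositionalEquality as ≡
import Relation.Binary.Reasoning.Setoid as ≈-Reasoning

-- With σ = -s² each factor is (x+i+s)(x+i-s), and the sum becomes a terminating 3F2 with upper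
-- parameters -n, y, 2d+y+n+1 and lower parameters x+1+s, x+1-s; it is balanced because x = d+y.
-- Only s² enters, so differentiating in σ gives 1/(x+i)² and no first-order harmonic numbers. The
-- product over k < i ≤ n has logarithmic derivative H_n - H_k, so the ε-part alone does not isolate
-- H_k; the part at σ = 0 is needed as well. The obstacle in the induction is that n also occurs in
-- the parameter 2d+y+n+1, so Pascal's rule leaves sums that are not instances of the identity. They
-- are compared with the instances at (n, d, y+1), (n, d+1, y) and (n-1, d+1, y+1), and the two
-- correction terms turn out to be the same. Without denominators, these shifts of d and y need no
-- nonvanishing conditions.

module Saalschütz {c ℓ} (R : CommutativeRing c ℓ) where

  open CommutativeRing R
  open Mult semiring using () renaming (_×_ to _×ⁿ_)
  open Solver commutativeSemiring using (solve; _:=_; _:+_; _:*_; con)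
  open ≈-Reasoning setoid

  ⟪_⟫ : ℕ → Carrier
  ⟪ n ⟫ = n ×ⁿ 1#

  -- Pascal's rule unrolled: Δ n f = ∑ₖ (-1)ᵏ C(n,k) f k (n - k).
  Δ : ℕ → (ℕ → ℕ → Carrier) → Carrier
  Δ zero    f = f 0 0
  Δ (suc n) f = Δ n (λ k j → f k (suc j)) + - 1# * Δ n (λ k j → f (suc k) j)

  rise : Carrier → ℕ → Carrier
  rise u zero    = 1#
  rise u (suc k) = rise u k * (u + ⟪ k ⟫)

  E : Carrier → Carrier → Carrier
  E σ a = (a + 1#) * (a + 1#) + σ

  -- Q σ n a = ∏ ((a + i)² + σ) over 1 ≤ i ≤ n.
  Q : Carrier → ℕ → Carrier → Carrier
  Q σ zero    a = 1#
  Q σ (suc n) a = E σ a * Q σ n (a + 1#)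

  -- Algebra of alternating binomial sums.

  -- Subtraction is spelled with a factor `- 1#` because the semiring solver knows no negation: it
  -- treats `- 1#` as an atom, and 1 + (-1) = 0 is applied by hand.
  transpose : ∀ {a b c d} → a + b ≈ c + d → a + - 1# * d ≈ c + - 1# * b
  transpose {a} {b} {c} {d} a+b≈c+d = begin
    a + - 1# * d                           ≈⟨ +-identityʳ _ ⟨
    a + - 1# * d + 0#                      ≈⟨ +-congˡ (cancel b) ⟨
    a + - 1# * d + (1# + - 1#) * b
      ≈⟨ solve 4 (λ a b d e → a :+ e :* d :+ (con 1 :+ e) :* b
           := a :+ b :+ (e :* d :+ e :* b)) refl a b d (- 1#) ⟩
    a + b + (- 1# * d + - 1# * b)          ≈⟨ +-congʳ a+b≈c+d ⟩
    c + d + (- 1# * d + - 1# * b)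
      ≈⟨ solve 4 (λ b c d e → c :+ d :+ (e :* d :+ e :* b)
           := c :+ e :* b :+ (con 1 :+ e) :* d) refl b c d (- 1#) ⟩
    c + - 1# * b + (1# + - 1#) * d         ≈⟨ +-congˡ (cancel d) ⟩
    c + - 1# * b + 0#                      ≈⟨ +-identityʳ _ ⟩
    c + - 1# * b                           ∎
    where
    cancel : ∀ x → (1# + - 1#) * x ≈ 0#
    cancel x = trans (*-congʳ (-‿inverseʳ 1#)) (zeroˡ x)

  Δ-cong : ∀ n {f g} → (∀ k j → f k j ≈ g k j) → Δ n f ≈ Δ n g
  Δ-cong zero    f≈g = f≈g 0 0
  Δ-cong (suc n) f≈g = +-cong (Δ-cong n λ k j → f≈g k (suc j))
    (*-congˡ (Δ-cong n λ k j → f≈g (suc k) j))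

  Δ-+ : ∀ n f g → Δ n (λ k j → f k j + g k j) ≈ Δ n f + Δ n g
  Δ-+ zero    f g = refl
  Δ-+ (suc n) f g = trans (+-cong (Δ-+ n _ _) (*-congˡ (Δ-+ n _ _)))
    (solve 5 (λ a b c d e → a :+ b :+ e :* (c :+ d) := a :+ e :* c :+ (b :+ e :* d)) refl _ _ _ _ _)

  Δ-* : ∀ n c f → Δ n (λ k j → c * f k j) ≈ c * Δ n f
  Δ-* zero    c f = refl
  Δ-* (suc n) c f = trans (+-cong (Δ-* n c _) (*-congˡ (Δ-* n c _)))
    (solve 4 (λ c a b e → c :* a :+ e :* (c :* b) := c :* (a :+ e :* b)) refl _ _ _ _)

  -- The absorption k C(n+1,k) = (n+1) C(n,k-1); the shift of k costs the sign. As `Δ` has no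
  -- explicit binomials, the proof follows its recursion, splitting k+1 into k and 1.
  Δ-absorb : ∀ n (f : ℕ → ℕ → Carrier) → Δ (suc n) (λ k j → ⟪ k ⟫ * f k j)
                   ≈ - 1# * (⟪ suc n ⟫ * Δ n (λ k j → f (suc k) j))
  Δ-absorb zero    f = solve 3 (λ a b e →
    con 0 :* a :+ e :* ((con 1 :+ con 0) :* b) := e :* ((con 1 :+ con 0) :* b)) refl _ _ _
  Δ-absorb (suc n) f = begin
    Δ (suc n) (λ k j → ⟪ k ⟫ * f° k j) + - 1# * Δ (suc n) (λ k j → ⟪ suc k ⟫ * f⁺ k j)
      ≈⟨ +-cong (Δ-absorb n f°) (*-congˡ (trans (Δ-cong (suc n) split)
           (trans (Δ-+ (suc n) (λ k j → ⟪ k ⟫ * f⁺ k j) f⁺) (+-congʳ (Δ-absorb n f⁺))))) ⟩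
    _ ≈⟨ solve 4 (λ e n a b → e :* (n :* a) :+ e :* (e :* (n :* b) :+ (a :+ e :* b))
           := e :* ((con 1 :+ n) :* (a :+ e :* b))) refl (- 1#) ⟪ suc n ⟫ _ _ ⟩
    - 1# * (⟪ suc (suc n) ⟫ * Δ (suc n) f⁺) ∎
    where
    f° f⁺ : ℕ → ℕ → Carrier
    f° k j = f k (suc j)
    f⁺ k j = f (suc k) j
    split : ∀ k j → ⟪ suc k ⟫ * f⁺ k j ≈ ⟪ k ⟫ * f⁺ k j + f⁺ k j
    split k j = solve 2 (λ k x → (con 1 :+ k) :* x := k :* x :+ x) refl ⟪ k ⟫ (f⁺ k j)

  rise-cong : ∀ {u v} k → u ≈ v → rise u k ≈ rise v k
  rise-cong zero    u≈v = refl
  rise-cong (suc k) u≈v = *-cong (rise-cong k u≈v) (+-congʳ u≈v)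

  rise-front : ∀ u k → u * rise (u + 1#) k ≈ rise u (suc k)
  rise-front u zero    = solve 1 (λ u → u :* con 1 := con 1 :* (u :+ con 0)) refl u
  rise-front u (suc k) = begin
    u * (rise (u + 1#) k * (u + 1# + ⟪ k ⟫))
      ≈⟨ solve 3 (λ u r k → u :* (r :* (u :+ con 1 :+ k)) := u :* r :* (u :+ (con 1 :+ k))) refl _ _ _ ⟩
    u * rise (u + 1#) k * (u + ⟪ suc k ⟫)   ≈⟨ *-congʳ (rise-front u k) ⟩
    rise u (suc k) * (u + ⟪ suc k ⟫)        ∎

  -- The last factor is u + k, and its part u moves to the front. At k = 0 the value of `ℕ.pred` is
  -- multiplied by 0.
  rise-shift : ∀ u k → rise (u + 1#) k ≈ rise u k + ⟪ k ⟫ * rise (u + 1#) (ℕ.pred k)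
  rise-shift u zero    = solve 0 (con 1 := con 1 :+ con 0 :* con 1) refl
  rise-shift u (suc k) = begin
    rise (u + 1#) k * (u + 1# + ⟪ k ⟫)
      ≈⟨ solve 3 (λ u r k → r :* (u :+ con 1 :+ k) := u :* r :+ (con 1 :+ k) :* r) refl _ _ _ ⟩
    u * rise (u + 1#) k + ⟪ suc k ⟫ * rise (u + 1#) k
      ≈⟨ +-congʳ (rise-front u k) ⟩
    rise u (suc k) + ⟪ suc k ⟫ * rise (u + 1#) k  ∎

  -- Saalschütz's summation in a commutative ring.

  module _ (σ : Carrier) where

    E-cong : ∀ {a b} → a ≈ b → E σ a ≈ E σ b
    E-cong a≈b = +-congʳ (*-cong (+-congʳ a≈b) (+-congʳ a≈b))

    Q-cong : ∀ n {a b} → a ≈ b → Q σ n a ≈ Q σ n b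
    Q-cong zero    a≈b = refl
    Q-cong (suc n) a≈b = *-cong (E-cong a≈b) (Q-cong n (+-congʳ a≈b))

    Q-+ : ∀ k j a → Q σ (k ℕ.+ j) a ≈ Q σ k a * Q σ j (a + ⟪ k ⟫)
    Q-+ zero    j a = sym (trans (*-identityˡ _) (Q-cong j (+-identityʳ a)))
    Q-+ (suc k) j a = trans (*-congˡ (trans (Q-+ k j (a + 1#)) (*-congˡ (Q-cong j (+-assoc _ _ _)))))
      (sym (*-assoc _ _ _))

    Q-snoc : ∀ n a → Q σ (suc n) a ≈ Q σ n a * E σ (a + ⟪ n ⟫)
    Q-snoc n a = begin
      Q σ (suc n) a               ≡⟨ ≡.cong (λ m → Q σ m a) (ℕ.+-comm 1 n) ⟩
      Q σ (n ℕ.+ 1) a             ≈⟨ Q-+ n 1 a ⟩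
      Q σ n a * (E σ (a + ⟪ n ⟫) * 1#)  ≈⟨ *-congˡ (*-identityʳ _) ⟩
      Q σ n a * E σ (a + ⟪ n ⟫)   ∎

    summand : ℕ → Carrier → Carrier → ℕ → ℕ → Carrier
    summand n d y k j = rise y k * rise (d + d + y + ⟪ n ⟫ + 1#) k * Q σ j (d + y + ⟪ k ⟫)

    module Step (n : ℕ) (d y : Carrier) where

      w : Carrier
      w = d + d + y + ⟪ suc n ⟫ + 1#

      -- `g` is almost the summand at d+1, but with `w` where that has `w + 1#`; `p` measures the
      -- defect. `p` is used only under a factor k or at a successor, so its value at 0 is
      -- immaterial.
      g p : ℕ → ℕ → Carrier
      g k j = rise y k * rise w k * Q σ j (d + y + ⟪ k ⟫ + 1#)
      p k j = rise y k * rise (w + 1#) (ℕ.pred k) * Q σ j (d + y + ⟪ k ⟫ + 1#)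

      -- (d+y+k+1)² + n(y+k) = (d+1)² + (y+k)(2d+y+n+2+k)
      exchange : ∀ k j → summand (suc n) d y k (suc j) + ⟪ n ⟫ * ((y + ⟪ k ⟫) * g k j)
                       ≈ E σ d * g k j + summand (suc n) d y (suc k) j
      exchange k j = begin
        summand (suc n) d y k (suc j) + ⟪ n ⟫ * ((y + ⟪ k ⟫) * g k j)
          -- `Q σ (suc j)` releases its first factor `E σ (d + y + ⟪ k ⟫)`; σ then contributes the
          -- same term to both sides.
          ≈⟨ solve 8 (λ d y σ n k r s q →
               let w = d :+ d :+ y :+ (con 1 :+ n) :+ con 1
                   e = λ a → (a :+ con 1) :* (a :+ con 1) :+ σ in
               r :* s :* (e (d :+ y :+ k) :* q) :+ n :* ((y :+ k) :* (r :* s :* q))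
               := e d :* (r :* s :* q) :+ r :* (y :+ k) :* (s :* (w :+ k)) :* q)
             refl d y σ ⟪ n ⟫ ⟪ k ⟫ _ _ _ ⟩
        E σ d * g k j + rise y (suc k) * rise w (suc k) * Q σ j (d + y + ⟪ k ⟫ + 1#)
          ≈⟨ +-congˡ (*-congˡ (Q-cong j
               (solve 2 (λ a k → a :+ k :+ con 1 := a :+ (con 1 :+ k)) refl _ _))) ⟩
        E σ d * g k j + summand (suc n) d y (suc k) j ∎

      -- Makes the extra term of `exchange` an instance of the identity: (y)ₖ(y+k) = y(y+1)ₖ, and
      -- trading n+1 for n while y becomes y+1 preserves `w`.
      raise-y : ∀ k j → (y + ⟪ k ⟫) * g k j ≈ y * summand n d (y + 1#) k j
      raise-y k j = begin
        (y + ⟪ k ⟫) * g k j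
          ≈⟨ solve 4 (λ a r s q → a :* (r :* s :* q) := r :* a :* s :* q) refl _ _ _ _ ⟩
        rise y (suc k) * rise w k * Q σ j (d + y + ⟪ k ⟫ + 1#)
          ≈⟨ *-cong (*-cong (sym (rise-front y k)) (rise-cong k
               (solve 3 (λ d y n → d :+ d :+ y :+ (con 1 :+ n) :+ con 1
                 := d :+ d :+ (y :+ con 1) :+ n :+ con 1) refl d y ⟪ n ⟫)))
             (Q-cong j (solve 3 (λ d y k → d :+ y :+ k :+ con 1 := d :+ (y :+ con 1) :+ k) refl _ _ _)) ⟩
        y * rise (y + 1#) k * rise (d + d + (y + 1#) + ⟪ n ⟫ + 1#) k * Q σ j (d + (y + 1#) + ⟪ k ⟫)
          ≈⟨ solve 4 (λ a r s q → a :* r :* s :* q := a :* (r :* s :* q)) refl _ _ _ _ ⟩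
        y * summand n d (y + 1#) k j ∎

      -- Raising d adds 2 to 2d+y+n+1 where raising n adds 1; `rise-shift` bridges the difference.
      raise-d : ∀ k j → summand n (d + 1#) y k j ≈ g k j + ⟪ k ⟫ * p k j
      raise-d k j = begin
        summand n (d + 1#) y k j
          ≈⟨ *-cong (*-congˡ (trans (rise-cong k
               (solve 3 (λ d y n → d :+ con 1 :+ (d :+ con 1) :+ y :+ n :+ con 1
                 := d :+ d :+ y :+ (con 1 :+ n) :+ con 1 :+ con 1) refl d y ⟪ n ⟫))
               (rise-shift w k)))
             (Q-cong j (solve 3 (λ d y k → d :+ con 1 :+ y :+ k := d :+ y :+ k :+ con 1) refl _ _ _)) ⟩
        rise y k * (rise w k + ⟪ k ⟫ * rise (w + 1#) (ℕ.pred k)) * Q σ j (d + y + ⟪ k ⟫ + 1#)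
          ≈⟨ solve 5 (λ r s k t q → r :* (s :+ k :* t) :* q := r :* s :* q :+ k :* (r :* t :* q))
             refl _ _ _ _ _ ⟩
        g k j + ⟪ k ⟫ * p k j ∎

    p-suc : ∀ n d y k j → Step.p (suc n) d y (suc k) j ≈ y * summand n (d + 1#) (y + 1#) k j
    p-suc n d y k j = begin
      rise y (suc k) * rise (w + 1#) k * Q σ j (d + y + ⟪ suc k ⟫ + 1#)
        ≈⟨ *-cong (*-cong (sym (rise-front y k)) (rise-cong k
             (solve 3 (λ d y n → d :+ d :+ y :+ (con 1 :+ (con 1 :+ n)) :+ con 1 :+ con 1
               := d :+ con 1 :+ (d :+ con 1) :+ (y :+ con 1) :+ n :+ con 1) refl d y ⟪ n ⟫)))
           (Q-cong j (solve 3 (λ d y k → d :+ y :+ (con 1 :+ k) :+ con 1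
             := d :+ con 1 :+ (y :+ con 1) :+ k) refl _ _ _)) ⟩
      y * rise (y + 1#) k * rise (d + 1# + (d + 1#) + (y + 1#) + ⟪ n ⟫ + 1#) k
        * Q σ j (d + 1# + (y + 1#) + ⟪ k ⟫)
        ≈⟨ solve 4 (λ a r s q → a :* r :* s :* q := a :* (r :* s :* q)) refl _ _ _ _ ⟩
      y * summand n (d + 1#) (y + 1#) k j ∎
      where open Step (suc n) d y

    saalschütz : ∀ n d y → Δ n (summand n d y) ≈ Q σ n d

    -- This is saalschütz n (d + 1#) y, expanded by raise-d; the correction
    -- term is an instance of saalschütz (n - 1).
    lowering : ∀ n d y → E σ d * Q σ n (d + 1#)
                       ≈ E σ d * Δ n (Step.g n d y) + - 1# * (⟪ n ⟫ * (y * Q σ n d))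

    saalschütz zero    d y = solve 0 (con 1 :* con 1 :* con 1 := con 1) refl
    saalschütz (suc n) d y = begin
      F° + - 1# * F⁺        ≈⟨ transpose F°+X≈G+F⁺ ⟩
      -- The same `X` occurs in `lowering`, so `G` is eliminated without a closed form.
      E σ d * G + - 1# * X  ≈⟨ lowering n d y ⟨
      E σ d * Q σ n (d + 1#) ∎
      where
      open Step n d y
      F° F⁺ G X : Carrier
      F° = Δ n (λ k j → summand (suc n) d y k (suc j))
      F⁺ = Δ n (λ k j → summand (suc n) d y (suc k) j)
      G  = Δ n g
      X  = ⟪ n ⟫ * (y * Q σ n d)
      F°+X≈G+F⁺ : F° + X ≈ E σ d * G + F⁺
      F°+X≈G+F⁺ = begin
        F° + ⟪ n ⟫ * (y * Q σ n d)
          ≈⟨ +-congˡ (*-congˡ (*-congˡ (saalschütz n d (y + 1#)))) ⟨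
        F° + ⟪ n ⟫ * (y * Δ n (summand n d (y + 1#)))
          ≈⟨ +-congˡ (*-congˡ (trans (Δ-cong n raise-y) (Δ-* n y _))) ⟨
        F° + ⟪ n ⟫ * Δ n (λ k j → (y + ⟪ k ⟫) * g k j)
          ≈⟨ trans (Δ-+ n _ _) (+-congˡ (Δ-* n ⟪ n ⟫ _)) ⟨
        Δ n (λ k j → summand (suc n) d y k (suc j) + ⟪ n ⟫ * ((y + ⟪ k ⟫) * g k j))
          ≈⟨ Δ-cong n exchange ⟩
        Δ n (λ k j → E σ d * g k j + summand (suc n) d y (suc k) j)
          ≈⟨ trans (Δ-+ n _ _) (+-congʳ (Δ-* n _ g)) ⟩
        E σ d * G + F⁺ ∎

    lowering zero d y = solve 3 (λ a y e → a :* con 1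
      := a :* (con 1 :* con 1 :* con 1) :+ e :* (con 0 :* (y :* con 1))) refl _ _ _
    lowering n@(suc m) d y = begin
      E σ d * Q σ n (d + 1#)
        ≈⟨ *-congˡ (saalschütz n (d + 1#) y) ⟨
      E σ d * Δ n (summand n (d + 1#) y)
        ≈⟨ *-congˡ (trans (Δ-cong n raise-d) (Δ-+ n g (λ k j → ⟪ k ⟫ * p k j))) ⟩
      E σ d * (Δ n g + Δ n (λ k j → ⟪ k ⟫ * p k j))
        ≈⟨ *-congˡ (+-congˡ (Δ-absorb m p)) ⟩
      E σ d * (Δ n g + - 1# * (⟪ n ⟫ * Δ m (λ k j → p (suc k) j)))
        ≈⟨ *-congˡ (+-congˡ (*-congˡ (*-congˡ (trans (Δ-cong m (p-suc m d y))
             (trans (Δ-* m y _) (*-congˡ (saalschütz m (d + 1#) (y + 1#)))))))) ⟩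
      E σ d * (Δ n g + - 1# * (⟪ n ⟫ * (y * Q σ m (d + 1#))))
        -- `E σ d * Q σ m (d + 1#)` is `Q σ n d` by definition.
        ≈⟨ solve 6 (λ a g e n y q → a :* (g :+ e :* (n :* (y :* q)))
             := a :* g :+ e :* (n :* (y :* (a :* q)))) refl _ _ _ ⟪ n ⟫ _ _ ⟩
      E σ d * Δ n g + - 1# * (⟪ n ⟫ * (y * Q σ n d)) ∎
      where open Step n d y

-- Differentiation in σ.

module DualNumbers {c ℓ} (R : CommutativeRing c ℓ) where

  open CommutativeRing R
  open Saalschütz R
  open Solver commutativeSemiring using (solve; _:=_; _:+_; _:*_; con)
  open ≈-Reasoning setoid

  -- The idealization of R as a module over itself is R[ε]/(ε²); second components multiply by the
  -- Leibniz rule.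
  dualNumbers : CommutativeRing c ℓ
  dualNumbers = record { isCommutativeRing = record
    { isRing = Idealization.isRingᴺ ring TensorUnit.bimodule
    ; *-comm = λ (a , a′) (b , b′) → *-comm a b ,
        solve 4 (λ a a′ b b′ → a :* b′ :+ a′ :* b := b :* a′ :+ b′ :* a) refl a a′ b b′
    } }

  module 𝔻 = CommutativeRing dualNumbers
  module D = Saalschütz dualNumbers

  ε : 𝔻.Carrier
  ε = 0# , 1#

  -- ∏ ((a + i)² + ε) = V n a + V′ n a ε, where ε² = 0.
  V V′ : ℕ → Carrier → Carrier
  V  n a = proj₁ (D.Q ε n (a , 0#))
  V′ n a = proj₂ (D.Q ε n (a , 0#))

  Δ-proj₁ : ∀ n f → proj₁ (D.Δ n f) ≈ Δ n (λ k j → proj₁ (f k j))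
  Δ-proj₁ zero    f = refl
  Δ-proj₁ (suc n) f = +-cong (Δ-proj₁ n _) (*-congˡ (Δ-proj₁ n _))

  -0≈0 : - 0# ≈ 0#
  -0≈0 = trans (sym (+-identityˡ _)) (-‿inverseʳ 0#)

  Δ-proj₂ : ∀ n f → proj₂ (D.Δ n f) ≈ Δ n (λ k j → proj₂ (f k j))
  Δ-proj₂ zero    f = refl
  Δ-proj₂ (suc n) f = +-cong (Δ-proj₂ n _) (trans
    (+-cong (*-congˡ (Δ-proj₂ n _)) (trans (*-congʳ -0≈0) (zeroˡ _))) (+-identityʳ _))

  ⟪⟫-lift : ∀ k → D.⟪ k ⟫ 𝔻.≈ (⟪ k ⟫ , 0#)
  ⟪⟫-lift zero    = 𝔻.refl
  ⟪⟫-lift (suc k) = +-congˡ (proj₁ (⟪⟫-lift k)) , trans (+-identityˡ _) (proj₂ (⟪⟫-lift k))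

  +-lift : ∀ {a′ b′ a b} → a′ 𝔻.≈ (a , 0#) → b′ 𝔻.≈ (b , 0#) → a′ 𝔻.+ b′ 𝔻.≈ (a + b , 0#)
  +-lift p q = 𝔻.trans (𝔻.+-cong p q) (refl , +-identityˡ 0#)

  *-lift : ∀ {a′ b′ a b} → a′ 𝔻.≈ (a , 0#) → b′ 𝔻.≈ (b , 0#) → a′ 𝔻.* b′ 𝔻.≈ (a * b , 0#)
  *-lift {a = a} {b} p q = 𝔻.trans (𝔻.*-cong p q)
    (refl , solve 2 (λ a b → a :* con 0 :+ con 0 :* b := con 0) refl a b)

  rise-lift : ∀ {u′ u} k → u′ 𝔻.≈ (u , 0#) → D.rise u′ k 𝔻.≈ (rise u k , 0#)
  rise-lift zero    p = 𝔻.refl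
  rise-lift (suc k) p = *-lift (rise-lift k p) (+-lift p (⟪⟫-lift k))

  Q-lift : ∀ {a′ a} n → a′ 𝔻.≈ (a , 0#) → D.Q ε n a′ 𝔻.≈ (V n a , V′ n a)
  Q-lift n p = D.Q-cong ε n p

  coeff : ℕ → Carrier → Carrier → ℕ → Carrier
  coeff n d y k = rise y k * rise (d + d + y + ⟪ n ⟫ + 1#) k

  -- Only `Q` involves ε: the rising factorials are constants, so `coeff` scales both components.
  summand-lift : ∀ n d y k j → D.summand ε n (d , 0#) (y , 0#) k j
    𝔻.≈ (coeff n d y k * V j (d + y + ⟪ k ⟫) , coeff n d y k * V′ j (d + y + ⟪ k ⟫))
  summand-lift n d y k j = 𝔻.trans
    (𝔻.*-cong
      (*-lift (rise-lift k 𝔻.refl)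
        (rise-lift k (+-lift (+-lift (+-lift 2d 𝔻.refl) (⟪⟫-lift n)) 𝔻.refl)))
      (Q-lift j (+-lift (+-lift 𝔻.refl 𝔻.refl) (⟪⟫-lift k))))
    (refl , trans (+-congˡ (zeroˡ _)) (+-identityʳ _))
    where
    2d : (d , 0#) 𝔻.+ (d , 0#) 𝔻.≈ (d + d , 0#)
    2d = +-lift 𝔻.refl 𝔻.refl

  saalschütz-V : ∀ n d y → Δ n (λ k j → coeff n d y k * V j (d + y + ⟪ k ⟫)) ≈ V n d
  saalschütz-V n d y = begin
    Δ n (λ k j → coeff n d y k * V j (d + y + ⟪ k ⟫))
      ≈⟨ Δ-cong n (λ k j → proj₁ (summand-lift n d y k j)) ⟨
    Δ n (λ k j → proj₁ (D.summand ε n (d , 0#) (y , 0#) k j))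
      ≈⟨ Δ-proj₁ n _ ⟨
    proj₁ (D.Δ n (D.summand ε n (d , 0#) (y , 0#)))
      ≈⟨ proj₁ (D.saalschütz ε n (d , 0#) (y , 0#)) ⟩
    V n d ∎

  saalschütz-V′ : ∀ n d y → Δ n (λ k j → coeff n d y k * V′ j (d + y + ⟪ k ⟫)) ≈ V′ n d
  saalschütz-V′ n d y = begin
    Δ n (λ k j → coeff n d y k * V′ j (d + y + ⟪ k ⟫))
      ≈⟨ Δ-cong n (λ k j → proj₂ (summand-lift n d y k j)) ⟨
    Δ n (λ k j → proj₂ (D.summand ε n (d , 0#) (y , 0#) k j))
      ≈⟨ Δ-proj₂ n _ ⟨
    proj₂ (D.Δ n (D.summand ε n (d , 0#) (y , 0#)))
      ≈⟨ proj₂ (D.saalschütz ε n (d , 0#) (y , 0#)) ⟩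
    V′ n d ∎

  -- The components are the multiplicativity of `V` and the Leibniz rule for `V′`.
  Q-split : ∀ k j a → D.Q ε (k ℕ.+ j) (a , 0#) 𝔻.≈
    (V k a , V′ k a) 𝔻.* (V j (a + ⟪ k ⟫) , V′ j (a + ⟪ k ⟫))
  Q-split k j a = 𝔻.trans (D.Q-+ ε k j (a , 0#)) (𝔻.*-congˡ (Q-lift j (+-lift 𝔻.refl (⟪⟫-lift k))))

  Q-step : ∀ n a → let s = a + ⟪ n ⟫ + 1# in
    D.Q ε (suc n) (a , 0#) 𝔻.≈ (V n a , V′ n a) 𝔻.* (s * s , 1#)
  Q-step n a = 𝔻.trans (D.Q-snoc ε n (a , 0#)) (𝔻.*-congˡ {x = V n a , V′ n a}
    (𝔻.trans (𝔻.+-congʳ {x = ε} (*-lift s-lift s-lift)) (+-identityʳ _ , +-identityˡ _)))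
    where
    s-lift : (a , 0#) 𝔻.+ D.⟪ n ⟫ 𝔻.+ 𝔻.1# 𝔻.≈ (a + ⟪ n ⟫ + 1# , 0#)
    s-lift = +-lift (+-lift 𝔻.refl (⟪⟫-lift n)) 𝔻.refl

  V-cong : ∀ n {a b} → a ≈ b → V n a ≈ V n b
  V-cong n a≈b = proj₁ (D.Q-cong ε n (a≈b , refl))

  V′-cong : ∀ n {a b} → a ≈ b → V′ n a ≈ V′ n b
  V′-cong n a≈b = proj₂ (D.Q-cong ε n (a≈b , refl))

  V≈rise² : ∀ n a → V n a ≈ rise (a + 1#) n * rise (a + 1#) n
  V≈rise² zero    a = sym (*-identityʳ 1#)
  V≈rise² (suc n) a = begin
    V (suc n) a
      ≈⟨ proj₁ (Q-step n a) ⟩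
    V n a * ((a + ⟪ n ⟫ + 1#) * (a + ⟪ n ⟫ + 1#))
      ≈⟨ *-congʳ (V≈rise² n a) ⟩
    rise (a + 1#) n * rise (a + 1#) n * ((a + ⟪ n ⟫ + 1#) * (a + ⟪ n ⟫ + 1#))
      ≈⟨ solve 3 (λ r a n → r :* r :* ((a :+ n :+ con 1) :* (a :+ n :+ con 1))
           := r :* (a :+ con 1 :+ n) :* (r :* (a :+ con 1 :+ n))) refl _ _ _ ⟩
    rise (a + 1#) (suc n) * rise (a + 1#) (suc n) ∎

-- The identity is transported from an arbitrary Heyting field to ℂ through
-- this record: two signatures are compared operation by operation, whereas
-- comparing the two sides of the identity over ℂ directly would unfold them
-- into rational arithmetic.
record Signature c ℓ₁ ℓ₂ : Set (Level.suc (c ⊔ ℓ₁ ⊔ ℓ₂)) where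
  infix  9 ⟦_⟧
  infix  8 -_
  infixr 8 _^_
  infixl 7 _*_ _/_[_]
  infixl 6 _+_ _-_
  infix  4 _≈_ _#_ _∉-[_⋯_]
  field
    Carrier  : Set c
    _≈_      : Carrier → Carrier → Set ℓ₁
    _#_      : Carrier → Carrier → Set ℓ₂
    _+_      : Carrier → Carrier → Carrier
    _*_      : Carrier → Carrier → Carrier
    _-_      : Carrier → Carrier → Carrier
    -_       : Carrier → Carrier
    0#       : Carrier
    1#       : Carrier
    _^_      : Carrier → ℕ → Carrier
    ⟦_⟧      : ℕ → Carrier
    _/_[_]   : Carrier → (v : Carrier) → v # 0# → Carrier
    ∑≤       : ∀ n → (∀ k → k ℕ.≤ n → Carrier) → Carrier
    binom    : Carrier → ℕ → Carrier
    _∉-[_⋯_] : Carrier → ℕ → ℕ → Set ℓ₂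
    restrict : ∀ {u n k} → k ℕ.≤ n → u ∉-[ 1 ⋯ n ] → u ∉-[ 1 ⋯ k ]
    +#0      : ∀ {u n} → u ∉-[ 0 ⋯ n ] → ∀ k → k ℕ.≤ n → u + ⟦ k ⟧ # 0#
    binom²#0 : ∀ {u} k → u ∉-[ 1 ⋯ k ] → binom (u + ⟦ k ⟧) k ^ 2 # 0#
    H        : ∀ ℓ → .{{NonZero ℓ}} → ∀ n u → u ∉-[ 1 ⋯ n ] → Carrier

record Identity {c ℓ₁ ℓ₂} (S : Signature c ℓ₁ ℓ₂) : Set (c ⊔ ℓ₁ ⊔ ℓ₂) where
  open Signature S
  field
    identity : ∀ (n : ℕ) (x y : Carrier)
      (hx  : x ∉-[ 1 ⋯ n ])
      (hxy : (x - y) ∉-[ 1 ⋯ n ])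
      (hy  : y ∉-[ 0 ⋯ n ]) →
      ∑≤ n (λ k k≤n →
          (- 1#) ^ k * binom ⟦ n ⟧ k
          * ((binom (⟦ 2 ⟧ * x - y + ⟦ n ⟧ + ⟦ k ⟧) k * binom (y + ⟦ k ⟧) k)
              / binom (x + ⟦ k ⟧) k ^ 2 [ binom²#0 k (restrict k≤n hx) ])
          * (y / (y + ⟦ k ⟧) [ +#0 hy k k≤n ])
          * H 2 k x (restrict k≤n hx))
      ≈ (binom (x - y + ⟦ n ⟧) n ^ 2)
          / binom (x + ⟦ n ⟧) n ^ 2 [ binom²#0 n hx ]
        * (H 2 n x hx - H 2 n (x - y) hxy)

-- Binomials and harmonic numbers over a field.

module FieldIdentity
  {c ℓ₁ ℓ₂} (F : HeytingField c ℓ₁ ℓ₂)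
  (suc#0 : ∀ n → HeytingField._#_ F (fromℕ F (suc n)) (HeytingField.0# F))
  where

  open CharacteristicZero F suc#0
  open HeytingField F using (_#_; #⇒invertible; heytingCommutativeRing)
  open HeytingCommutativeRing heytingCommutativeRing using (commutativeRing)
  open CommutativeRing commutativeRing
  open HeytingProperties heytingCommutativeRing using (x-0≈x; x#0y#0→xy#0)
  open RingProperties ring using (-‿+-comm; -‿distribʳ-*)
  open Mult semiring using (×1-homo-*)
  open Sum semiring using (sum; sum-cong-≋; ∑-distrib-+; *-distribˡ-sum; *-distribʳ-sum)
  open Solver commutativeSemiring using (solve; _:=_; _:+_; _:*_; con)
  open ≈-Reasoning setoid
  open Saalschütz commutativeRing using (Δ; Δ-cong; rise; rise-front; rise-cong)
  open DualNumbers commutativeRing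

  /-*-cancel : ∀ u {v} (v#0 : v # 0#) → u / v [ v#0 ] * v ≈ u
  /-*-cancel u {v} v#0 = begin
    u * w * v           ≈⟨ *-assoc _ _ _ ⟩
    u * (w * v)         ≈⟨ *-congˡ (*-congˡ (x-0≈x v)) ⟨
    u * (w * (v - 0#))  ≈⟨ *-congˡ (proj₁ (proj₂ (#⇒invertible v#0))) ⟩
    u * 1#              ≈⟨ *-identityʳ u ⟩
    u                   ∎
    where
    w : Carrier
    w = proj₁ (#⇒invertible v#0)

  *-cancelʳ-# : ∀ {u v w} → w # 0# → u * w ≈ v * w → u ≈ v
  *-cancelʳ-# {u} {v} {w} w#0 uw≈vw = begin
    u                    ≈⟨ /-*-cancel u w#0 ⟨
    u / w [ w#0 ] * w    ≈⟨ solve 3 (λ u i w → u :* i :* w := u :* w :* i) refl _ _ _ ⟩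
    (u * w) / w [ w#0 ]  ≈⟨ *-congʳ uw≈vw ⟩
    (v * w) / w [ w#0 ]  ≈⟨ solve 3 (λ u i w → u :* i :* w := u :* w :* i) refl _ _ _ ⟨
    v / w [ w#0 ] * w    ≈⟨ /-*-cancel v w#0 ⟩
    v                    ∎

  binom-* : ∀ u k → binom u k * ⟦ k ! ⟧ ≈ fallingFactorial u k
  binom-* u k = /-*-cancel _ (!#0 k)

  -- Trades the division by k! for a ring equation.
  binom-unique : ∀ {u w} k → fallingFactorial u k ≈ w * ⟦ k ! ⟧ → binom u k ≈ w
  binom-unique {u} k p = *-cancelʳ-# (!#0 k) (trans (binom-* u k) p)

  fallingFactorial-cong : ∀ {u v} k → u ≈ v → fallingFactorial u k ≈ fallingFactorial v k
  fallingFactorial-cong zero    u≈v = refl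
  fallingFactorial-cong (suc k) u≈v = *-cong (fallingFactorial-cong k u≈v) (+-congʳ u≈v)

  fallingFactorial-suc : ∀ u k →
    fallingFactorial (u + 1#) (suc k) ≈ (u + 1#) * fallingFactorial u k
  fallingFactorial-suc u zero    = begin
    1# * (u + 1# - 0#)  ≈⟨ *-identityˡ _ ⟩
    u + 1# - 0#         ≈⟨ x-0≈x _ ⟩
    u + 1#              ≈⟨ *-identityʳ _ ⟨
    (u + 1#) * 1#       ∎
  fallingFactorial-suc u (suc k) = begin
    fallingFactorial (u + 1#) (suc k) * (u + 1# - (1# + ⟦ k ⟧))
      ≈⟨ *-cong (fallingFactorial-suc u k) shift ⟩
    (u + 1#) * fallingFactorial u k * (u - ⟦ k ⟧)
      ≈⟨ *-assoc _ _ _ ⟩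
    (u + 1#) * fallingFactorial u (suc k) ∎
    where
    shift : u + 1# - (1# + ⟦ k ⟧) ≈ u - ⟦ k ⟧
    shift = begin
      u + 1# - (1# + ⟦ k ⟧)        ≈⟨ +-congˡ (-‿+-comm 1# ⟦ k ⟧) ⟨
      u + 1# + (- 1# - ⟦ k ⟧)
        ≈⟨ solve 3 (λ u e m → u :+ con 1 :+ (e :+ m) := u :+ m :+ (con 1 :+ e)) refl u (- 1#) (- ⟦ k ⟧) ⟩
      u - ⟦ k ⟧ + (1# - 1#)        ≈⟨ +-congˡ (-‿inverseʳ 1#) ⟩
      u - ⟦ k ⟧ + 0#               ≈⟨ +-identityʳ _ ⟩
      u - ⟦ k ⟧                    ∎

  fallingFactorial≈rise : ∀ u k → fallingFactorial (u + ⟦ k ⟧) k ≈ rise (u + 1#) k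
  fallingFactorial≈rise u zero    = refl
  fallingFactorial≈rise u (suc k) = begin
    fallingFactorial (u + (1# + ⟦ k ⟧)) (suc k)
      ≈⟨ fallingFactorial-cong (suc k) (solve 2 (λ u k → u :+ (con 1 :+ k) := u :+ k :+ con 1) refl _ _) ⟩
    fallingFactorial (u + ⟦ k ⟧ + 1#) (suc k)
      ≈⟨ fallingFactorial-suc (u + ⟦ k ⟧) k ⟩
    (u + ⟦ k ⟧ + 1#) * fallingFactorial (u + ⟦ k ⟧) k
      ≈⟨ *-congˡ (fallingFactorial≈rise u k) ⟩
    (u + ⟦ k ⟧ + 1#) * rise (u + 1#) k
      ≈⟨ solve 3 (λ u k r → (u :+ k :+ con 1) :* r := r :* (u :+ con 1 :+ k)) refl _ _ _ ⟩
    rise (u + 1#) (suc k) ∎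

  binom-rise : ∀ u k → binom (u + ⟦ k ⟧) k * ⟦ k ! ⟧ ≈ rise (u + 1#) k
  binom-rise u k = trans (binom-* (u + ⟦ k ⟧) k) (fallingFactorial≈rise u k)

  binom-zero : ∀ u → binom u 0 ≈ 1#
  binom-zero u = binom-unique {u} 0 (sym (trans (*-identityˡ _) (+-identityʳ _)))

  binom-top : ∀ n → binom ⟦ n ⟧ (suc n) ≈ 0#
  binom-top n = binom-unique (suc n) (begin
    fallingFactorial ⟦ n ⟧ n * (⟦ n ⟧ - ⟦ n ⟧)  ≈⟨ *-congˡ (-‿inverseʳ ⟦ n ⟧) ⟩
    fallingFactorial ⟦ n ⟧ n * 0#               ≈⟨ zeroʳ _ ⟩
    0#                                          ≈⟨ zeroˡ _ ⟨
    0# * ⟦ suc n ! ⟧                            ∎)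

  -- After multiplication by (k+1)!, the right side is (k+1)f + (n-k)f = (n+1)f for the common
  -- falling factorial f.
  pascal : ∀ n k → binom ⟦ suc n ⟧ (suc k) ≈ binom ⟦ n ⟧ k + binom ⟦ n ⟧ (suc k)
  pascal n k = binom-unique (suc k) (sym (begin
    (b + b⁺) * ⟦ suc k ! ⟧                         ≈⟨ distribʳ _ _ _ ⟩
    b * ⟦ suc k ! ⟧ + b⁺ * ⟦ suc k ! ⟧             ≈⟨ +-cong (*-congˡ (×1-homo-* (suc k) (k !))) (binom-* ⟦ n ⟧ (suc k)) ⟩
    b * (⟦ suc k ⟧ * ⟦ k ! ⟧) + f * (⟦ n ⟧ - ⟦ k ⟧)
      ≈⟨ +-congʳ (solve 3 (λ a b c → a :* (b :* c) := a :* c :* b) refl _ ⟦ suc k ⟧ _) ⟩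
    b * ⟦ k ! ⟧ * ⟦ suc k ⟧ + f * (⟦ n ⟧ - ⟦ k ⟧)  ≈⟨ +-congʳ (*-congʳ (binom-* ⟦ n ⟧ k)) ⟩
    f * ⟦ suc k ⟧ + f * (⟦ n ⟧ - ⟦ k ⟧)
      ≈⟨ solve 4 (λ f k n m → f :* (con 1 :+ k) :+ f :* (n :+ m) := (n :+ con 1) :* f :+ (k :+ m) :* f)
           refl f ⟦ k ⟧ ⟦ n ⟧ (- ⟦ k ⟧) ⟩
    (⟦ n ⟧ + 1#) * f + (⟦ k ⟧ - ⟦ k ⟧) * f         ≈⟨ +-congˡ (trans (*-congʳ (-‿inverseʳ ⟦ k ⟧)) (zeroˡ f)) ⟩
    (⟦ n ⟧ + 1#) * f + 0#                          ≈⟨ +-identityʳ _ ⟩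
    (⟦ n ⟧ + 1#) * f                               ≈⟨ fallingFactorial-suc ⟦ n ⟧ k ⟨
    fallingFactorial (⟦ n ⟧ + 1#) (suc k)          ≈⟨ fallingFactorial-cong (suc k) (+-comm _ _) ⟩
    fallingFactorial ⟦ suc n ⟧ (suc k)             ∎))
    where
    b b⁺ f : Carrier
    b  = binom ⟦ n ⟧ k
    b⁺ = binom ⟦ n ⟧ (suc k)
    f  = fallingFactorial ⟦ n ⟧ k

  weight : ℕ → ℕ → Carrier
  weight n k = (- 1#) ^ k * binom ⟦ n ⟧ k

  sum< : ℕ → (ℕ → Carrier) → Carrier
  sum< m f = sum {m} λ i → f (toℕ i)

  sum<-snoc : ∀ m f → sum< (suc m) f ≈ sum< m f + f m
  sum<-snoc zero    f = +-comm _ _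
  sum<-snoc (suc m) f = trans (+-congˡ (sum<-snoc m (λ k → f (suc k)))) (sym (+-assoc _ _ _))

  ∑≤-cong : ∀ n {f g} → (∀ k k≤n → f k k≤n ≈ g k k≤n) → ∑≤ n f ≈ ∑≤ n g
  ∑≤-cong n f≈g = sum-cong-≋ {suc n} λ i → f≈g (toℕ i) (toℕ≤pred[n] i)

  ∑≤-+ : ∀ n f g → ∑≤ n (λ k k≤n → f k k≤n + g k k≤n) ≈ ∑≤ n f + ∑≤ n g
  ∑≤-+ n f g = ∑-distrib-+ {suc n} (λ i → f (toℕ i) (toℕ≤pred[n] i)) (λ i → g (toℕ i) (toℕ≤pred[n] i))

  ∑≤-*ˡ : ∀ n c f → c * ∑≤ n f ≈ ∑≤ n (λ k k≤n → c * f k k≤n)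
  ∑≤-*ˡ n c f = *-distribˡ-sum {suc n} c λ i → f (toℕ i) (toℕ≤pred[n] i)

  ∑≤-*ʳ : ∀ n c f → ∑≤ n f * c ≈ ∑≤ n (λ k k≤n → f k k≤n * c)
  ∑≤-*ʳ n c f = *-distribʳ-sum {suc n} c λ i → f (toℕ i) (toℕ≤pred[n] i)

  -- Once k = 0 is split off the first sum, both sums run over f (k+1) (n-k) and Pascal's rule
  -- merges their weights.
  Δ≈∑ : ∀ n f → Δ n f ≈ ∑≤ n λ k _ → weight n k * f k (n ∸ k)
  Δ≈∑ zero    f = begin
    f 0 0                        ≈⟨ *-identityˡ _ ⟨
    1# * f 0 0                   ≈⟨ *-congʳ (trans (*-identityˡ _) (binom-zero ⟦ 0 ⟧)) ⟨
    weight 0 0 * f 0 0           ≈⟨ +-identityʳ _ ⟨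
    weight 0 0 * f 0 0 + 0#      ∎
  Δ≈∑ (suc n) f = begin
    Δ n (λ k j → f k (suc j)) + - 1# * Δ n (λ k j → f (suc k) j)
      ≈⟨ +-cong (Δ≈∑ n _) (*-congˡ (Δ≈∑ n _)) ⟩
    ∑≤ n (λ k _ → weight n k * f k (suc (n ∸ k))) + - 1# * ∑≤ n (λ k _ → q k)
      ≈⟨ +-cong shift (∑≤-*ˡ n (- 1#) λ k _ → q k) ⟩
    weight n 0 * f 0 (suc n) + ∑≤ n (λ k _ → p k) + ∑≤ n (λ k _ → - 1# * q k)
      ≈⟨ +-assoc _ _ _ ⟩
    weight n 0 * f 0 (suc n) + (∑≤ n (λ k _ → p k) + ∑≤ n (λ k _ → - 1# * q k))
      ≈⟨ +-cong (*-congʳ (*-congˡ (trans (binom-zero ⟦ n ⟧) (sym (binom-zero ⟦ suc n ⟧)))))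
           (sym (∑≤-+ n (λ k _ → p k) (λ k _ → - 1# * q k))) ⟩
    weight (suc n) 0 * f 0 (suc n) + ∑≤ n (λ k _ → p k + - 1# * q k)
      ≈⟨ +-congˡ (∑≤-cong n λ k _ → recurrence k) ⟩
    weight (suc n) 0 * f 0 (suc n) + ∑≤ n (λ k _ → weight (suc n) (suc k) * f (suc k) (n ∸ k)) ∎
    where
    p q r : ℕ → Carrier
    p k = weight n (suc k) * f (suc k) (n ∸ k)
    q k = weight n k * f (suc k) (n ∸ k)
    r k = weight n k * f k (suc n ∸ k)

    recurrence : ∀ k → p k + - 1# * q k ≈ weight (suc n) (suc k) * f (suc k) (n ∸ k)
    recurrence k = trans
      (solve 5 (λ e p b b⁺ x → e :* p :* b⁺ :* x :+ e :* (p :* b :* x) := e :* p :* (b :+ b⁺) :* x)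
        refl (- 1#) ((- 1#) ^ k) (binom ⟦ n ⟧ k) (binom ⟦ n ⟧ (suc k)) (f (suc k) (n ∸ k)))
      (*-congʳ (*-congˡ (sym (pascal n k))))

    shift : ∑≤ n (λ k _ → weight n k * f k (suc (n ∸ k)))
          ≈ weight n 0 * f 0 (suc n) + ∑≤ n (λ k _ → p k)
    shift = begin
      ∑≤ n (λ k _ → weight n k * f k (suc (n ∸ k)))
        -- Truncated subtraction commutes with `suc` only because k ≤ n.
        ≈⟨ ∑≤-cong n (λ k k≤n → *-congˡ {weight n k} (reflexive
             (≡.cong (f k) (≡.sym (ℕ.+-∸-assoc 1 k≤n))))) ⟩
      sum< (suc n) r
        ≈⟨ +-identityʳ _ ⟨
      sum< (suc n) r + 0#
        -- The range is padded by k = n+1, where C(n,n+1) = 0.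
        ≈⟨ +-congˡ (trans (*-congʳ (trans (*-congˡ (binom-top n)) (zeroʳ _))) (zeroˡ _)) ⟨
      sum< (suc n) r + r (suc n)
        ≈⟨ sum<-snoc (suc n) r ⟨
      sum< (suc (suc n)) r ∎

  V′≈V*H : ∀ n a h → V′ n a ≈ V n a * H 2 n a h
  V′≈V*H zero    a h = sym (zeroʳ _)
  V′≈V*H (suc n) a h = begin
    V′ (suc n) a                          ≈⟨ proj₂ (Q-step n a) ⟩
    V n a * 1# + V′ n a * (s * s)
      -- The last factor s² + ε has derivative 1 = r s², with r the newest summand of `H`.
      ≈⟨ +-cong (*-congˡ (sym one)) (*-congʳ (V′≈V*H n a h′)) ⟩
    V n a * (r * (s * s)) + V n a * H 2 n a h′ * (s * s)
      ≈⟨ solve 4 (λ v r q h → v :* (r :* q) :+ v :* h :* q := v :* q :* (h :+ r)) refl _ _ _ _ ⟩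
    V n a * (s * s) * (H 2 n a h′ + r)    ≈⟨ *-congʳ (proj₁ (Q-step n a)) ⟨
    V (suc n) a * H 2 (suc n) a h         ∎
    where
    h′ : a ∉-[ 1 ⋯ n ]
    h′ = restrict (ℕ.n≤1+n n) h
    s r : Carrier
    s = a + ⟦ n ⟧ + 1#
    r = 1# / (a + ⟦ suc n ⟧) ^ 2 [ ^#0 2 (+#0 h (suc n) (s≤s z≤n) ℕ.≤-refl) ]
    one : r * (s * s) ≈ 1#
    one = trans (*-congˡ (solve 2 (λ a n → (a :+ n :+ con 1) :* (a :+ n :+ con 1)
        := (a :+ (con 1 :+ n)) :* ((a :+ (con 1 :+ n)) :* con 1)) refl a ⟦ n ⟧))
      (/-*-cancel 1# (^#0 2 (+#0 h (suc n) (s≤s z≤n) ℕ.≤-refl)))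

  V≈binom² : ∀ n a → V n a ≈ binom (a + ⟦ n ⟧) n ^ 2 * (⟦ n ! ⟧ * ⟦ n ! ⟧)
  V≈binom² n a = begin
    V n a                                            ≈⟨ V≈rise² n a ⟩
    rise (a + 1#) n * rise (a + 1#) n                ≈⟨ *-cong (binom-rise a n) (binom-rise a n) ⟨
    b * ⟦ n ! ⟧ * (b * ⟦ n ! ⟧)
      ≈⟨ solve 2 (λ b f → b :* f :* (b :* f) := b :* (b :* con 1) :* (f :* f)) refl _ _ ⟩
    b ^ 2 * (⟦ n ! ⟧ * ⟦ n ! ⟧)                      ∎
    where
    b : Carrier
    b = binom (a + ⟦ n ⟧) n

  V#0 : ∀ n {a} → a ∉-[ 1 ⋯ n ] → binom (a + ⟦ n ⟧) n ^ 2 * (⟦ n ! ⟧ * ⟦ n ! ⟧) # 0#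
  V#0 n h = x#0y#0→xy#0 (^#0 2 (binom#0 n h)) (x#0y#0→xy#0 (!#0 n) (!#0 n))

  -- The theorem over a field, with d = x - y.

  module _ (n : ℕ) (x y : Carrier) (hx : x ∉-[ 1 ⋯ n ]) (hy : y ∉-[ 0 ⋯ n ]) where

    ratio : ∀ k → k ℕ.≤ n → Carrier
    ratio k k≤n = (binom (⟦ 2 ⟧ * x - y + ⟦ n ⟧ + ⟦ k ⟧) k * binom (y + ⟦ k ⟧) k)
      / binom (x + ⟦ k ⟧) k ^ 2 [ ^#0 2 (binom#0 k (restrict k≤n hx)) ]

    unrise : ∀ k → k ℕ.≤ n → Carrier
    unrise k k≤n = y / (y + ⟦ k ⟧) [ +#0 hy k z≤n k≤n ]

    -- Multiplied by y+k, both sides become y(y+1)ₖ.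
    rise-unrise : ∀ k k≤n → rise (y + 1#) k * unrise k k≤n ≈ rise y k
    rise-unrise k k≤n = *-cancelʳ-# (+#0 hy k z≤n k≤n) (begin
      rise (y + 1#) k * unrise k k≤n * (y + ⟦ k ⟧)    ≈⟨ *-assoc _ _ _ ⟩
      rise (y + 1#) k * (unrise k k≤n * (y + ⟦ k ⟧))  ≈⟨ *-congˡ (/-*-cancel y _) ⟩
      rise (y + 1#) k * y                             ≈⟨ *-comm _ _ ⟩
      y * rise (y + 1#) k                             ≈⟨ rise-front y k ⟩
      rise y k * (y + ⟦ k ⟧)                          ∎)

    x≈d+y : x ≈ x - y + y
    x≈d+y = begin
      x              ≈⟨ +-identityʳ x ⟨
      x + 0#         ≈⟨ +-congˡ (-‿inverseˡ y) ⟨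
      x + (- y + y)  ≈⟨ +-assoc _ _ _ ⟨
      x - y + y      ∎

    -- Because 2d + y = x + d = 2x - y.
    coeff-rise : ∀ k → coeff n (x - y) y k ≈ rise y k * rise (⟦ 2 ⟧ * x - y + ⟦ n ⟧ + 1#) k
    coeff-rise k = *-congˡ (rise-cong k (begin
      x - y + (x - y) + y + ⟦ n ⟧ + 1#
        ≈⟨ solve 4 (λ x m y n → x :+ m :+ (x :+ m) :+ y :+ n :+ con 1
             := x :+ m :+ y :+ (x :+ m) :+ n :+ con 1) refl x (- y) y ⟦ n ⟧ ⟩
      x - y + y + (x - y) + ⟦ n ⟧ + 1#
        ≈⟨ +-congʳ (+-congʳ (+-congʳ x≈d+y)) ⟨
      x + (x - y) + ⟦ n ⟧ + 1#
        ≈⟨ solve 3 (λ x m n → x :+ (x :+ m) :+ n :+ con 1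
             := (con 1 :+ (con 1 :+ con 0)) :* x :+ m :+ n :+ con 1) refl x (- y) ⟦ n ⟧ ⟩
      ⟦ 2 ⟧ * x - y + ⟦ n ⟧ + 1# ∎))

    -- `V k x` supplies the squared denominator and (k!)², one k! for each binomial in the
    -- numerator.
    ratio*V : ∀ k k≤n → ratio k k≤n * unrise k k≤n * V k x ≈ coeff n (x - y) y k
    ratio*V k k≤n = begin
      ratio k k≤n * unrise k k≤n * V k x
        ≈⟨ *-congˡ (V≈binom² k x) ⟩
      ratio k k≤n * unrise k k≤n * (C * (⟦ k ! ⟧ * ⟦ k ! ⟧))
        ≈⟨ solve 4 (λ r u c f → r :* u :* (c :* (f :* f)) := r :* c :* (f :* f) :* u) refl _ _ _ _ ⟩
      ratio k k≤n * C * (⟦ k ! ⟧ * ⟦ k ! ⟧) * unrise k k≤n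
        ≈⟨ *-congʳ (*-congʳ (/-*-cancel (A * B) _)) ⟩
      A * B * (⟦ k ! ⟧ * ⟦ k ! ⟧) * unrise k k≤n
        ≈⟨ solve 4 (λ a b f u → a :* b :* (f :* f) :* u := (b :* f) :* u :* (a :* f)) refl _ _ _ _ ⟩
      B * ⟦ k ! ⟧ * unrise k k≤n * (A * ⟦ k ! ⟧)
        ≈⟨ *-cong (trans (*-congʳ (binom-rise y k)) (rise-unrise k k≤n)) (binom-rise _ k) ⟩
      rise y k * rise (⟦ 2 ⟧ * x - y + ⟦ n ⟧ + 1#) k
        ≈⟨ coeff-rise k ⟨
      coeff n (x - y) y k ∎
      where
      A B C : Carrier
      A = binom (⟦ 2 ⟧ * x - y + ⟦ n ⟧ + ⟦ k ⟧) k
      B = binom (y + ⟦ k ⟧) k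
      C = binom (x + ⟦ k ⟧) k ^ 2

    term : ∀ k → k ℕ.≤ n → Carrier
    term k k≤n = weight n k * ratio k k≤n * unrise k k≤n * H 2 k x (restrict k≤n hx)

    V-∸ : ∀ k → k ℕ.≤ n → V n x ≈ V k x * V (n ∸ k) (x + ⟦ k ⟧)
    V-∸ k k≤n = trans (reflexive (≡.cong (λ m → V m x) (≡.sym (ℕ.m+[n∸m]≡n k≤n))))
      (proj₁ (Q-split k (n ∸ k) x))

    V′-∸ : ∀ k → k ℕ.≤ n →
      V′ n x ≈ V k x * V′ (n ∸ k) (x + ⟦ k ⟧) + V′ k x * V (n ∸ k) (x + ⟦ k ⟧)
    V′-∸ k k≤n = trans (reflexive (≡.cong (λ m → V′ m x) (≡.sym (ℕ.m+[n∸m]≡n k≤n))))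
      (proj₂ (Q-split k (n ∸ k) x))

    -- Since V n x = V k x * V (n ∸ k) (x + k), the Leibniz rule turns the
    -- harmonic number H 2 k x into H 2 n x minus the logarithmic
    -- derivative of V (n ∸ k) (x + k).
    term*V : ∀ k k≤n →
      term k k≤n * V n x + weight n k * (coeff n (x - y) y k * V′ (n ∸ k) (x + ⟦ k ⟧))
      ≈ weight n k * (coeff n (x - y) y k * V (n ∸ k) (x + ⟦ k ⟧)) * H 2 n x hx
    term*V k k≤n = begin
      term k k≤n * V n x + b * (coeff n (x - y) y k * w′)
        ≈⟨ +-cong (*-congˡ (V-∸ k k≤n)) (*-congˡ (*-congʳ (sym (ratio*V k k≤n)))) ⟩
      b * r * u * hk * (v * w) + b * (r * u * v * w′)
        ≈⟨ solve 7 (λ b r u h v w w′ → b :* r :* u :* h :* (v :* w) :+ b :* (r :* u :* v :* w′)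
             := b :* r :* u :* (v :* w′ :+ v :* h :* w)) refl b r u hk v w w′ ⟩
      b * r * u * (v * w′ + v * hk * w)
        ≈⟨ *-congˡ (+-congˡ (*-congʳ (V′≈V*H k x (restrict k≤n hx)))) ⟨
      b * r * u * (v * w′ + V′ k x * w)
        ≈⟨ *-congˡ (V′-∸ k k≤n) ⟨
      b * r * u * V′ n x
        ≈⟨ *-congˡ (V′≈V*H n x hx) ⟩
      b * r * u * (V n x * hn)
        ≈⟨ *-congˡ (*-congʳ (V-∸ k k≤n)) ⟩
      b * r * u * (v * w * hn)
        ≈⟨ solve 6 (λ b r u v w h → b :* r :* u :* (v :* w :* h) := b :* (r :* u :* v :* w) :* h)
             refl b r u v w hn ⟩
      b * (r * u * v * w) * hn
        ≈⟨ *-congʳ (*-congˡ (*-congʳ (ratio*V k k≤n))) ⟩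
      b * (coeff n (x - y) y k * w) * hn ∎
      where
      b r u v w w′ hk hn : Carrier
      b  = weight n k
      r  = ratio k k≤n
      u  = unrise k k≤n
      v  = V k x
      w  = V (n ∸ k) (x + ⟦ k ⟧)
      w′ = V′ (n ∸ k) (x + ⟦ k ⟧)
      hk = H 2 k x (restrict k≤n hx)
      hn = H 2 n x hx

    p p′ : ℕ → Carrier
    p  k = weight n k * (coeff n (x - y) y k * V (n ∸ k) (x + ⟦ k ⟧))
    p′ k = weight n k * (coeff n (x - y) y k * V′ (n ∸ k) (x + ⟦ k ⟧))

    sum-V : ∑≤ n (λ k _ → p k) ≈ V n (x - y)
    sum-V = begin
      ∑≤ n (λ k _ → p k)
        ≈⟨ Δ≈∑ n (λ k j → coeff n (x - y) y k * V j (x + ⟦ k ⟧)) ⟨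
      Δ n (λ k j → coeff n (x - y) y k * V j (x + ⟦ k ⟧))
        ≈⟨ Δ-cong n (λ k j → *-congˡ (V-cong j (+-congʳ x≈d+y))) ⟩
      Δ n (λ k j → coeff n (x - y) y k * V j (x - y + y + ⟦ k ⟧))
        ≈⟨ saalschütz-V n (x - y) y ⟩
      V n (x - y) ∎

    sum-V′ : ∑≤ n (λ k _ → p′ k) ≈ V′ n (x - y)
    sum-V′ = begin
      ∑≤ n (λ k _ → p′ k)
        ≈⟨ Δ≈∑ n (λ k j → coeff n (x - y) y k * V′ j (x + ⟦ k ⟧)) ⟨
      Δ n (λ k j → coeff n (x - y) y k * V′ j (x + ⟦ k ⟧))
        ≈⟨ Δ-cong n (λ k j → *-congˡ (V′-cong j (+-congʳ x≈d+y))) ⟩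
      Δ n (λ k j → coeff n (x - y) y k * V′ j (x - y + y + ⟦ k ⟧))
        ≈⟨ saalschütz-V′ n (x - y) y ⟩
      V′ n (x - y) ∎

    -- In `term*V` the harmonic number on the right no longer depends on k, so it leaves the sum and
    -- both components of the summation over the dual numbers apply.
    sum*V : ∑≤ n term * V n x + V′ n (x - y) ≈ V n (x - y) * H 2 n x hx
    sum*V = begin
      ∑≤ n term * V n x + V′ n (x - y)
        ≈⟨ +-cong (∑≤-*ʳ n (V n x) term) (sym sum-V′) ⟩
      ∑≤ n (λ k k≤n → term k k≤n * V n x) + ∑≤ n (λ k _ → p′ k)
        ≈⟨ ∑≤-+ n (λ k k≤n → term k k≤n * V n x) (λ k _ → p′ k) ⟨
      ∑≤ n (λ k k≤n → term k k≤n * V n x + p′ k)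
        ≈⟨ ∑≤-cong n term*V ⟩
      ∑≤ n (λ k _ → p k * H 2 n x hx)
        ≈⟨ ∑≤-*ʳ n (H 2 n x hx) (λ k _ → p k) ⟨
      ∑≤ n (λ k _ → p k) * H 2 n x hx
        ≈⟨ *-congʳ sum-V ⟩
      V n (x - y) * H 2 n x hx ∎

    -- Rewriting `V′ n (x - y)` by its logarithmic derivative and dividing `sum*V` by `V n x` gives
    -- the claim; the factor (n!)² common to `V n x` and `V n (x - y)` cancels, leaving squared
    -- binomials.
    saalschütz-derivative : (hxy : (x - y) ∉-[ 1 ⋯ n ]) →
      ∑≤ n term ≈ (binom (x - y + ⟦ n ⟧) n ^ 2) / binom (x + ⟦ n ⟧) n ^ 2 [ ^#0 2 (binom#0 n hx) ]
        * (H 2 n x hx - H 2 n (x - y) hxy)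
    saalschütz-derivative hxy = *-cancelʳ-# (V#0 n hx) (begin
      ∑≤ n term * (C * N)                     ≈⟨ *-congˡ (V≈binom² n x) ⟨
      ∑≤ n term * V n x                       ≈⟨ +-identityʳ _ ⟨
      ∑≤ n term * V n x + 0#                  ≈⟨ +-congˡ (-‿inverseʳ _) ⟨
      ∑≤ n term * V n x + (V′ n (x - y) - V′ n (x - y))
                                              ≈⟨ +-assoc _ _ _ ⟨
      ∑≤ n term * V n x + V′ n (x - y) - V′ n (x - y)
        ≈⟨ +-cong sum*V (-‿cong (V′≈V*H n (x - y) hxy)) ⟩
      V n (x - y) * h - V n (x - y) * h′      ≈⟨ +-congˡ (-‿distribʳ-* _ _) ⟩
      V n (x - y) * h + V n (x - y) * - h′    ≈⟨ distribˡ _ _ _ ⟨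
      V n (x - y) * (h - h′)                  ≈⟨ *-congʳ (V≈binom² n (x - y)) ⟩
      B * N * (h - h′)                        ≈⟨ *-congʳ (*-congʳ (/-*-cancel B _)) ⟨
      B / C [ ^#0 2 (binom#0 n hx) ] * C * N * (h - h′)
        ≈⟨ solve 4 (λ r c f e → r :* c :* f :* e := r :* e :* (c :* f)) refl _ C N (h - h′) ⟩
      B / C [ ^#0 2 (binom#0 n hx) ] * (h - h′) * (C * N) ∎)
      where
      B C N h h′ : Carrier
      B = binom (x - y + ⟦ n ⟧) n ^ 2
      C = binom (x + ⟦ n ⟧) n ^ 2
      N = ⟦ n ! ⟧ * ⟦ n ! ⟧
      h = H 2 n x hx
      h′ = H 2 n (x - y) hxy

module _
  {c ℓ₁ ℓ₂} (F : HeytingField c ℓ₁ ℓ₂)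
  (suc#0 : ∀ n → HeytingField._#_ F (fromℕ F (suc n)) (HeytingField.0# F))
  where

  open CharacteristicZero F suc#0
  open HeytingField F using (Carrier; _≈_; _#_; _+_; _*_; _-_; -_; 0#; 1#)

  signature : Signature c ℓ₁ ℓ₂
  signature = record
    { Carrier = Carrier ; _≈_ = _≈_ ; _#_ = _#_
    ; _+_ = _+_ ; _*_ = _*_ ; _-_ = _-_ ; -_ = -_ ; 0# = 0# ; 1# = 1# ; _^_ = _^_
    ; ⟦_⟧ = ⟦_⟧ ; _/_[_] = _/_[_] ; ∑≤ = ∑≤ ; binom = binom ; _∉-[_⋯_] = _∉-[_⋯_]
    ; restrict = λ k≤n h → restrict k≤n h
    ; +#0 = λ h k k≤n → +#0 h k z≤n k≤n
    ; binom²#0 = λ k h → ^#0 2 (binom#0 k h)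
    ; H = H
    }

  harmonic-saalschütz : Identity signature
  harmonic-saalschütz = record { identity = λ n x y hx hxy hy →
    FieldIdentity.saalschütz-derivative F suc#0 n x y hx hy hxy }

-- Specialization to the complex numbers.

open import Defs

harmonic-saalschütz-ℂ : Identity (record
  { Carrier = ℂ ; _≈_ = _≈_ ; _#_ = _#_
  ; _+_ = _+_ ; _*_ = _*_ ; _-_ = _-_ ; -_ = -_ ; 0# = 0# ; 1# = 1# ; _^_ = _^_
  ; ⟦_⟧ = ⟦_⟧ ; _/_[_] = _/_[_] ; ∑≤ = ∑≤ ; binom = binom ; _∉-[_⋯_] = _∉-[_⋯_]
  ; restrict = λ k≤n h → restrict k≤n h
  ; +#0 = λ h k k≤n → +#0 h k z≤n k≤n
  ; binom²#0 = λ k h → ^#0 2 (binom#0 k h)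
  ; H = H
  })
harmonic-saalschütz-ℂ = harmonic-saalschütz Complex.heytingField Complex.characteristicZero

theorem2 : ∀ (n : ℕ) (x y : ℂ)
    (hx  : x ∉-[ 1 ⋯ n ])
    (hxy : (x - y) ∉-[ 1 ⋯ n ])
    (hy  : y ∉-[ 0 ⋯ n ]) →
    ∑≤ n (λ k k≤n →
    (- 1#) ^ k * binom ⟦ n ⟧ k
    * ((binom (⟦ 2 ⟧ * x - y + ⟦ n ⟧ + ⟦ k ⟧) k * binom (y + ⟦ k ⟧) k)
    / binom (x + ⟦ k ⟧) k ^ 2 [ ^#0 2 (binom#0 k (restrict k≤n hx)) ])
    * (y / (y + ⟦ k ⟧) [ +#0 hy k z≤n k≤n ])
    * H 2 k x (restrict k≤n hx))
    ≈ (binom (x - y + ⟦ n ⟧) n ^ 2)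
    / binom (x + ⟦ n ⟧) n ^ 2 [ ^#0 2 (binom#0 n hx) ]
    * (H 2 n x hx - H 2 n (x - y) hxy)
theorem2 = Identity.identity harmonic-saalschütz-ℂ
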